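{- Let $q$ be a prime power, $N\ge 3$, $1\le k\le N-1$, and let $2 \le \rho \le N$ and $\rho \le \ell \le (q^\rho-1)/(q-1)$ be integers. Then $$\hat{\delta}_q(N,k,\ell,\rho)= \frac{\lambda_q(N,k,\ell,\rho)}{\lambda_q(N,0,\ell,\rho)}.$$
   Context: Let $X$ be an $N$-dimensional $\mathbb{F}_q$-space, $\mathcal{G}_q(X,j)$ the set of its $j$-dimensional subspaces. A point set is a nonempty $P\subseteq\mathcal{G}_q(X,1)$, $\langle P\rangle=\sum_{L\in P}L$; $V\le X$ distinguishes $P$ if no element of $P$ lies in $V$. $\delta_q(X,k,P)$ is the number of $V\in\mathcal{G}_q(X,k)$ distinguishing $P$ divided by $|\mathcal{G}_q(X,k)|$. $\hat\delta_q(N,k,\ell,\rho)$ is the average of $\delta_q(X,k,P)$ over all point sets $P$ with $|P|=\ell$ and $\dim\langle P\rangle=\rho$. With $\begin{bmatrix} a\\ b\end{bmatrix}_q=\prod_{j=0}^{b-1}\frac{q^a-q^j}{q^b-q^j}$ (and $0$ if $b>a$ or $b<0$), for $0\le s\le N$ define $$\lambda_q(N,s,\ell,\rho)= \sum_{i=0}^\rho (-1)^{\rho-i} \, q^{\binom{\rho-i}{2}} \begin{bmatrix} N-i\\ \rho-i\end{bmatrix}_q \sum_{t=0}^s \binom{\frac{q^i-q^t}{q-1}}{\ell} \begin{bmatrix} s\\ t\end{bmatrix}_q \begin{bmatrix} N-s\\ i-t\end{bmatrix}_q q^{(s-t)(i-t)}.$$ -}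

module Defs where

open import Data.Nat as ℕ using (ℕ; zero; suc; _≤_; _∸_; _^_)
open import Data.Nat.DivMod as ℕD using ()
open import Data.Nat.Primality using (Prime)
open import Data.Nat.Combinatorics using (_C_)
open import Data.Integer as ℤ using (ℤ; +_; -[1+_])
open import Data.Rational as ℚ using (ℚ; 0ℚ; 1ℚ)
open import Data.Rational.Properties using () renaming (_≟_ to _≟ℚ_)
open import Data.Fin using (Fin)
open import Data.Fin.Properties using () renaming (_≟_ to _≟F_)
open import Data.Vec as V using (Vec; []; _∷_)
open import Data.Vec.Properties using (≡-dec)
open import Data.List as L using (List; []; _∷_; _++_; map; concatMap; filterᵇ; length; upTo; allFin; foldr; concat; null)
open import Data.Bool using (Bool; true; false; _∧_; _∨_; not)
open import Data.Bool.ListAction using (all; any)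
open import Data.Product using (Σ; _×_)
open import Relation.Nullary using (yes; no; does)
open import Relation.Binary.PropositionalEquality using (_≡_; _≢_)
open import Algebra.Structures using (IsCommutativeRing)

IsPrimePower : ℕ → Set
IsPrimePower q = Σ ℕ λ p → Σ ℕ λ m → Prime p × 1 ≤ m × q ≡ p ^ m

record FiniteField (q : ℕ) : Set where
  infixl 6 _+_
  infixl 7 _*_
  field
    _+_ _*_ : Fin q → Fin q → Fin q
    -_      : Fin q → Fin q
    0# 1#   : Fin q
    isCommutativeRing : IsCommutativeRing _≡_ _+_ _*_ -_ 0# 1#
    0≢1     : 0# ≢ 1#
    inverse : ∀ x → x ≢ 0# → Σ (Fin q) λ y → x * y ≡ 1#

-- Total divisions (value 0 when dividing by 0; only used with nonzero
-- denominators in the statement)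
_/ℚ_ : ℚ → ℚ → ℚ
p /ℚ r with r ≟ℚ 0ℚ
... | yes _  = 0ℚ
... | no r≢0 = ℚ._÷_ p r {{ℚ.≢-nonZero r≢0}}

_/ℕ_ : ℕ → ℕ → ℕ
m /ℕ n with n ℕ.≟ 0
... | yes _  = 0
... | no n≢0 = ℕD._/_ m n {{ℕ.≢-nonZero n≢0}}

ℕ→ℚ : ℕ → ℚ
ℕ→ℚ n = + n ℚ./ 1

sumℚ : List ℚ → ℚ
sumℚ = foldr ℚ._+_ 0ℚ

prodℚ : List ℚ → ℚ
prodℚ = foldr ℚ._*_ 1ℚ

sumTo : ℕ → (ℕ → ℚ) → ℚ
sumTo n f = sumℚ (map f (upTo (suc n)))

sign : ℕ → ℚ
sign zero    = 1ℚ
sign (suc n) = ℚ.- sign n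

gaussℕ : ℕ → ℕ → ℕ → ℚ
gaussℕ q a b with a ℕ.<? b
... | yes _ = 0ℚ
... | no _  = prodℚ (map (λ j → (ℕ→ℚ (q ^ a) ℚ.- ℕ→ℚ (q ^ j)) /ℚ (ℕ→ℚ (q ^ b) ℚ.- ℕ→ℚ (q ^ j))) (upTo b))

gauss : ℕ → ℕ → ℤ → ℚ
gauss q a (+ b)     = gaussℕ q a b
gauss q a -[1+ _ ]  = 0ℚ

lam : ℕ → ℕ → ℕ → ℕ → ℕ → ℚ
lam q N s ℓ ρ =
  sumTo ρ λ i →
    sign (ρ ∸ i) ℚ.* ℕ→ℚ (q ^ ((ρ ∸ i) C 2)) ℚ.* gaussℕ q (N ∸ i) (ρ ∸ i) ℚ.*
    sumTo s (λ t →
      ℕ→ℚ (((q ^ i ∸ q ^ t) /ℕ (q ∸ 1)) C ℓ) ℚ.* gaussℕ q s t ℚ.*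
      gauss q (N ∸ s) (+ i ℤ.- + t) ℚ.* ℕ→ℚ (q ^ ((s ∸ t) ℕ.* (i ∸ t))))

listsOf : {A : Set} → ℕ → List A → List (List A)
listsOf zero    xs = [] ∷ []
listsOf (suc m) xs = concatMap (λ x → map (x ∷_) (listsOf m xs)) xs

-- all sublists (= all subsets of a duplicate-free list, each exactly once)
sublists : {A : Set} → List A → List (List A)
sublists []       = [] ∷ []
sublists (x ∷ xs) = map (x ∷_) (sublists xs) ++ sublists xs

_⇔ᵇ_ : Bool → Bool → Bool
a ⇔ᵇ b = (a ∧ b) ∨ (not a ∧ not b)

-- Linear algebra in X = F_q^N; subsets of X are represented as sublists
-- of the enumeration allVecs N.
module Over {q : ℕ} (F : FiniteField q) where
  open FiniteField F

  Pt : ℕ → Set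
  Pt N = Vec (Fin q) N

  allVecs : (N : ℕ) → List (Pt N)
  allVecs zero    = [] ∷ []
  allVecs (suc N) = concatMap (λ a → map (a ∷_) (allVecs N)) (allFin q)

  _≟V_ : ∀ {N} (u v : Pt N) → _
  _≟V_ = ≡-dec _≟F_

  zeroV : ∀ N → Pt N
  zeroV N = V.replicate N 0#

  lincomb : ∀ {N} → List (Fin q) → List (Pt N) → Pt N
  lincomb (c ∷ cs) (g ∷ gs) = V.zipWith _+_ (V.map (c *_) g) (lincomb cs gs)
  lincomb {N} _ _ = zeroV N

  coeffs : ℕ → List (List (Fin q))
  coeffs m = listsOf m (allFin q)

  inSpan : ∀ {N} → List (Pt N) → Pt N → Bool
  inSpan gs v = any (λ cs → does (lincomb cs gs ≟V v)) (coeffs (length gs))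

  independent : ∀ {N} → List (Pt N) → Bool
  independent {N} gs =
    all (λ cs → not (does (lincomb cs gs ≟V zeroV N)) ∨ all (λ c → does (c ≟F 0#)) cs)
        (coeffs (length gs))

  _∈ᵇ_ : ∀ {N} → Pt N → List (Pt N) → Bool
  v ∈ᵇ S = any (λ w → does (v ≟V w)) S

  isSubspaceOfDim : ∀ {N} → ℕ → List (Pt N) → Bool
  isSubspaceOfDim {N} k S =
    any (λ gs → independent gs ∧ all (λ v → inSpan gs v ⇔ᵇ (v ∈ᵇ S)) (allVecs N))
        (listsOf k (allVecs N))

  Grass : (N k : ℕ) → List (List (Pt N))
  Grass N k = filterᵇ (isSubspaceOfDim k) (sublists (allVecs N))

  _⊆ᵇ_ : ∀ {N} → List (Pt N) → List (Pt N) → Bool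
  L ⊆ᵇ W = all (_∈ᵇ W) L

  distinguishes : ∀ {N} → List (Pt N) → List (List (Pt N)) → Bool
  distinguishes W P = all (λ L → not (L ⊆ᵇ W)) P

  ⟨_⟩ : ∀ {N} → List (List (Pt N)) → List (Pt N)
  ⟨_⟩ {N} P = filterᵇ (inSpan (concat P)) (allVecs N)

  pointSets : (N ℓ ρ : ℕ) → List (List (List (Pt N)))
  pointSets N ℓ ρ =
    filterᵇ (λ P → not (null P) ∧ does (length P ℕ.≟ ℓ) ∧ isSubspaceOfDim ρ ⟨ P ⟩)
            (sublists (Grass N 1))

  δ : (N k : ℕ) → List (List (Pt N)) → ℚ
  δ N k P = ℕ→ℚ (length (filterᵇ (λ W → distinguishes W P) (Grass N k)))
            /ℚ ℕ→ℚ (length (Grass N k))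

  δ̂ : (N k ℓ ρ : ℕ) → ℚ
  δ̂ N k ℓ ρ = sumℚ (map (δ N k) (pointSets N ℓ ρ)) /ℚ ℕ→ℚ (length (pointSets N ℓ ρ))

{-# OPTIONS --safe #-}
module Submission where

-- Exchanging the sums over P and V reduces the claim to λ_q(N,s,ℓ,ρ) being the number B_ρ of
-- ℓ-sets P of points that avoid a fixed s-dimensional V and span a space of dimension ρ.
-- Let A_i count the pairs (U, P) with dim U = i and P an ℓ-set of points of U outside V.
-- Summing over U first, according to t = dim (U ∩ V), gives the inner sum of λ_q: U contains
-- (q^i − q^t)/(q − 1) points outside V, and there are [s t] [N−s i−t] q^((s−t)(i−t)) such U.
-- Summing over P first gives A_i = ∑_r B_r [N−r i−r], the number of U above ⟨P⟩ being the case
-- V = ⟨P⟩, s = t = r of the same count.  Since [M−j n−j] [M j] = [M n] [n j] and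
-- ∑_j (−1)^(n−j) q^(n−j choose 2) [n j] vanishes for n > 0, the outer sum of λ_q recovers B_ρ.
-- Dimensions are read off cardinalities throughout: a closed subset has dimension r iff it
-- has q^r elements.

open import Defs
open import Algebra.Bundles using (CommutativeRing)
open import Data.Bool using (Bool; true; false; _∧_; _∨_; not; T)
open import Data.Bool.ListAction using (all; any)
open import Data.Bool.Properties using (T?)
open import Data.Empty using (⊥; ⊥-elim)
open import Data.Fin using (Fin)
open import Data.Fin.Properties using () renaming (_≟_ to _≟F_)
open import Data.Integer as ℤ using () renaming (+_ to pos)
import Data.Integer.Properties as ℤ
open import Data.List using (List; []; _∷_; _++_; map; concatMap; filterᵇ; length; upTo; allFin; concat; null; cartesianProductWith)
open import Data.List.Membership.Propositional using (_∈_)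
open import Data.List.Membership.Propositional.Properties
open import Data.List.Properties using (upTo-∷ʳ; map-++; length-tabulate)
open import Data.List.Relation.Unary.All as All using ([]; _∷_)
open import Data.List.Relation.Unary.AllPairs using ([]; _∷_)
open import Data.List.Relation.Unary.Any using (here; there)
open import Data.List.Relation.Unary.Unique.Propositional using (Unique)
import Data.List.Relation.Unary.Unique.Propositional.Properties as Unique
open import Data.Nat
open import Data.Nat.Combinatorics using (_C_; nCk+nC[k+1]≡[n+1]C[k+1]; nC1≡n)
import Data.Nat.DivMod as ℕ
open import Data.Nat.Properties
open import Data.Nat.Tactic.RingSolver using (solve-∀)
open import Data.Product using (∃; _×_; _,_; proj₁; proj₂)
open import Data.Rational as ℚ using (ℚ; 0ℚ; 1ℚ; toℚᵘ)
import Data.Rational.Properties as ℚ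
import Data.Rational.Solver
open import Data.Rational.Unnormalised.Base as ℚᵘ using (mkℚᵘ; *≡*)
import Data.Rational.Unnormalised.Properties as ℚᵘ
open import Data.Sum using (inj₁; inj₂)
open import Data.Vec as V using ([]; _∷_)
open import Function using (_∘_; id)
open import Relation.Binary.PropositionalEquality
open import Relation.Nullary using (Dec; yes; no; does; ¬_; contradiction)
open import Relation.Nullary.Decidable using (dec-true; dec-false)

-- The count depends on `V` only through its dimension `s`. Summing the proportions over all
-- admissible `P` is therefore averaging a constant over `V`, which gives the numerator. For `s = 0`
-- the fixed subspace is the origin, which contains no point, so the count becomes the number of all
-- admissible `P`, the denominator. The two quotients thus agree term by term. The inversion is
-- carried out on the indicator of a single `P` of rank `r`, so point sets are never grouped by
-- rank. The obstacle is division: Gaussian binomials occur as products of rational quotients, and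
-- subspaces as lists found by a search for a basis. Numbers of independent tuples are plain
-- products in ℕ, so each subspace count is obtained by counting suitable bases in two ways and
-- cancelling a positive factor. An integer form `G` of the Gaussian binomial keeps this
-- cancellation inside ℕ; rationals enter only where signs do.

module ℚ-Solver = Data.Rational.Solver.+-*-Solver
open ℚ-Solver using (_:+_; _:*_; :-_; _:=_)

private variable
  A B D : Set

-- Boolean tests and list membership.

true≢false : true ≢ false
true≢false ()

bool-ext : ∀ {a b} → (a ≡ true → b ≡ true) → (b ≡ true → a ≡ true) → a ≡ b
bool-ext {false} {false} _ _ = refl
bool-ext {true}  {b}     f _ = sym (f refl)
bool-ext {false} {true}  _ g = g refl

∧-intro : ∀ {a b} → a ≡ true → b ≡ true → a ∧ b ≡ true
∧-intro refl refl = refl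

∧-elim : ∀ {a b} → a ∧ b ≡ true → a ≡ true × b ≡ true
∧-elim {true} {true} _ = refl , refl

not-intro : ∀ {a} → ¬ (a ≡ true) → not a ≡ true
not-intro {true}  h = ⊥-elim (h refl)
not-intro {false} _ = refl

not-elim : ∀ {a} → not a ≡ true → ¬ (a ≡ true)
not-elim {true} () _
not-elim {false} _ ()

¬true⇒false : ∀ {a} → ¬ (a ≡ true) → a ≡ false
¬true⇒false {true}  h = ⊥-elim (h refl)
¬true⇒false {false} _ = refl

does-sound : {P : Set} (d : Dec P) → does d ≡ true → P
does-sound (yes p) _ = p

any-intro : (p : A → Bool) {xs : List A} {x : A} → x ∈ xs → p x ≡ true → any p xs ≡ true
any-intro p (here refl) e rewrite e = refl
any-intro p {y ∷ xs} (there m) e with p y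
... | true  = refl
... | false = any-intro p m e

any-elim : (p : A → Bool) (xs : List A) → any p xs ≡ true → ∃ λ x → x ∈ xs × p x ≡ true
any-elim p (x ∷ xs) e with p x in eq
... | true  = x , here refl , eq
... | false with any-elim p xs e
...   | y , m , h = y , there m , h

all-intro : (p : A → Bool) (xs : List A) → (∀ {x} → x ∈ xs → p x ≡ true) → all p xs ≡ true
all-intro p []       h = refl
all-intro p (x ∷ xs) h = ∧-intro (h (here refl)) (all-intro p xs (h ∘ there))

all-elim : (p : A → Bool) {xs : List A} → all p xs ≡ true → ∀ {x} → x ∈ xs → p x ≡ true
all-elim p e (here refl) = proj₁ (∧-elim e)
all-elim p e (there m)   = all-elim p (proj₂ (∧-elim e)) m

all-∧ : (p r : A → Bool) (xs : List A) → all (λ x → p x ∧ r x) xs ≡ all p xs ∧ all r xs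
all-∧ p r xs = bool-ext
  (λ h → ∧-intro (all-intro p xs (λ m → proj₁ (∧-elim (all-elim (λ x → p x ∧ r x) h m))))
                 (all-intro r xs (λ m → proj₂ (∧-elim (all-elim (λ x → p x ∧ r x) h m)))))
  (λ h → all-intro _ xs (λ m → ∧-intro (all-elim p (proj₁ (∧-elim h)) m) (all-elim r (proj₂ (∧-elim h)) m)))

∈-filterᵇ⁺ : (p : A → Bool) {xs : List A} {x : A} → x ∈ xs → p x ≡ true → x ∈ filterᵇ p xs
∈-filterᵇ⁺ p m e = ∈-filter⁺ (T? ∘ p) m (subst T (sym e) _)

∈-filterᵇ⁻ : (p : A → Bool) (xs : List A) {x : A} → x ∈ filterᵇ p xs → x ∈ xs × p x ≡ true
∈-filterᵇ⁻ p xs {x} m with ∈-filter⁻ (T? ∘ p) {xs = xs} m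
... | m′ , t with p x
...   | true = m′ , refl

-- Finite sums and indicator functions

⟦_⟧ : Bool → ℕ
⟦ true ⟧  = 1
⟦ false ⟧ = 0

⟦∧⟧ : ∀ a b → ⟦ a ∧ b ⟧ ≡ ⟦ a ⟧ * ⟦ b ⟧
⟦∧⟧ true  b = sym (+-identityʳ ⟦ b ⟧)
⟦∧⟧ false b = refl

∑ : List A → (A → ℕ) → ℕ
∑ []       f = 0
∑ (x ∷ xs) f = f x + ∑ xs f

length-filterᵇ : (p : A → Bool) (xs : List A) → length (filterᵇ p xs) ≡ ∑ xs (λ x → ⟦ p x ⟧)
length-filterᵇ p []       = refl
length-filterᵇ p (x ∷ xs) with p x
... | true  = cong suc (length-filterᵇ p xs)
... | false = length-filterᵇ p xs

∑-filterᵇ : (p : A → Bool) (xs : List A) (f : A → ℕ) →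
  ∑ (filterᵇ p xs) f ≡ ∑ xs (λ x → ⟦ p x ⟧ * f x)
∑-filterᵇ p []       f = refl
∑-filterᵇ p (x ∷ xs) f with p x
... | true  = cong₂ _+_ (sym (+-identityʳ (f x))) (∑-filterᵇ p xs f)
... | false = ∑-filterᵇ p xs f

∑-cong∈ : (xs : List A) {f g : A → ℕ} → (∀ {x} → x ∈ xs → f x ≡ g x) → ∑ xs f ≡ ∑ xs g
∑-cong∈ []       h = refl
∑-cong∈ (x ∷ xs) h = cong₂ _+_ (h (here refl)) (∑-cong∈ xs (h ∘ there))

∑-cong : (xs : List A) {f g : A → ℕ} → (∀ x → f x ≡ g x) → ∑ xs f ≡ ∑ xs g
∑-cong xs h = ∑-cong∈ xs (λ {x} _ → h x)

∑-zero : (xs : List A) → ∑ xs (λ _ → 0) ≡ 0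
∑-zero []       = refl
∑-zero (x ∷ xs) = ∑-zero xs

∑-const : (xs : List A) (c : ℕ) → ∑ xs (λ _ → c) ≡ length xs * c
∑-const []       c = refl
∑-const (x ∷ xs) c = cong (c +_) (∑-const xs c)

∑-distrib-+ : (xs : List A) (f g : A → ℕ) → ∑ xs (λ x → f x + g x) ≡ ∑ xs f + ∑ xs g
∑-distrib-+ []       f g = refl
∑-distrib-+ (x ∷ xs) f g rewrite ∑-distrib-+ xs f g = lem (f x) (g x) (∑ xs f) (∑ xs g)
  where
  lem : ∀ a b c d → a + b + (c + d) ≡ a + c + (b + d)
  lem = solve-∀

∑-*ˡ : (xs : List A) (c : ℕ) (f : A → ℕ) → ∑ xs (λ x → c * f x) ≡ c * ∑ xs f
∑-*ˡ []       c f = sym (*-zeroʳ c)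
∑-*ˡ (x ∷ xs) c f rewrite ∑-*ˡ xs c f = sym (*-distribˡ-+ c (f x) (∑ xs f))

∑-*ʳ : (xs : List A) (f : A → ℕ) (c : ℕ) → ∑ xs (λ x → f x * c) ≡ ∑ xs f * c
∑-*ʳ xs f c = trans (∑-cong xs (λ x → *-comm (f x) c)) (trans (∑-*ˡ xs c f) (*-comm c (∑ xs f)))

∑-swap : (xs : List A) (ys : List B) (f : A → B → ℕ) →
  ∑ xs (λ x → ∑ ys (f x)) ≡ ∑ ys (λ y → ∑ xs (λ x → f x y))
∑-swap []       ys f = sym (∑-zero ys)
∑-swap (x ∷ xs) ys f =
  trans (cong (∑ ys (f x) +_) (∑-swap xs ys f)) (sym (∑-distrib-+ ys (f x) (λ y → ∑ xs (λ z → f z y))))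

∑-++ : (xs ys : List A) (f : A → ℕ) → ∑ (xs ++ ys) f ≡ ∑ xs f + ∑ ys f
∑-++ []       ys f = refl
∑-++ (x ∷ xs) ys f = trans (cong (f x +_) (∑-++ xs ys f)) (sym (+-assoc (f x) _ _))

∑-map : (g : A → B) (xs : List A) (f : B → ℕ) → ∑ (map g xs) f ≡ ∑ xs (f ∘ g)
∑-map g []       f = refl
∑-map g (x ∷ xs) f = cong (f (g x) +_) (∑-map g xs f)

∑-concatMap : (g : A → List B) (xs : List A) (f : B → ℕ) → ∑ (concatMap g xs) f ≡ ∑ xs (λ x → ∑ (g x) f)
∑-concatMap g []       f = refl
∑-concatMap g (x ∷ xs) f = trans (∑-++ (g x) (concatMap g xs) f) (cong (∑ (g x) f +_) (∑-concatMap g xs f))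

∑-mono : (xs : List A) {f g : A → ℕ} → (∀ x → f x ≤ g x) → ∑ xs f ≤ ∑ xs g
∑-mono []       h = z≤n
∑-mono (x ∷ xs) h = +-mono-≤ (h x) (∑-mono xs h)

-- This turns an inclusion of subsets of equal size into an equality, the substitute for every
-- argument that compares dimensions.
∑-mono-≡ : (xs : List A) {f g : A → ℕ} → (∀ x → f x ≤ g x) → ∑ xs f ≡ ∑ xs g →
  ∀ {x} → x ∈ xs → f x ≡ g x
∑-mono-≡ (x ∷ xs) {f} {g} h e m = go m
  where
  fx≡gx : f x ≡ g x
  fx≡gx = ≤-antisym (h x) (+-cancelʳ-≤ (∑ xs f) (g x) (f x)
    (≤-trans (+-monoʳ-≤ (g x) (∑-mono xs h)) (≤-reflexive (sym e))))
  go : ∀ {y} → y ∈ x ∷ xs → f y ≡ g y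
  go (here refl) = fx≡gx
  go (there m′)  = ∑-mono-≡ xs h (+-cancelˡ-≡ (f x) _ _ (trans e (cong (_+ ∑ xs g) (sym fx≡gx)))) m′

∑-unique : {xs : List A} → Unique xs → (f : A → ℕ) {a : A} → a ∈ xs →
  (∀ {x} → x ∈ xs → x ≢ a → f x ≡ 0) → ∑ xs f ≡ f a
∑-unique {xs = x ∷ xs} (x∉ ∷ u) f (here refl) h =
  trans (cong (f x +_) (trans (∑-cong∈ xs (λ m → h (there m) (λ e → All.lookup x∉ m (sym e)))) (∑-zero xs)))
        (+-identityʳ (f x))
∑-unique {xs = x ∷ xs} (x∉ ∷ u) f (there m) h =
  cong₂ _+_ (h (here refl) (All.lookup x∉ m)) (∑-unique u f m (h ∘ there))

count-unique : {xs : List A} → Unique xs → (p : A → Bool) {a : A} → a ∈ xs → p a ≡ true →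
  (∀ {x} → x ∈ xs → p x ≡ true → x ≡ a) → ∑ xs (λ x → ⟦ p x ⟧) ≡ 1
count-unique u p {a} m e h =
  trans (∑-unique u (λ x → ⟦ p x ⟧) m
           (λ m′ x≢a → cong ⟦_⟧ (¬true⇒false (λ px → x≢a (h m′ px)))))
        (cong ⟦_⟧ e)

-- The indicator of `σ y ≡ x` has exactly one support point in `y` and one in `x`, so exchanging the
-- two summations replaces any reasoning about permutations of lists.
∑-bijection : {xs : List A} → Unique xs → (∀ x → x ∈ xs) → (π σ : A → A) →
  (∀ x → σ (π x) ≡ x) → (∀ x → π (σ x) ≡ x) → (_≟A_ : (x y : A) → Dec (x ≡ y)) →
  (f : A → ℕ) → ∑ xs (f ∘ π) ≡ ∑ xs f
∑-bijection {xs = xs} u c π σ σπ πσ _≟A_ f = begin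
  ∑ xs (λ x → f (π x))
    ≡⟨ ∑-cong xs (λ x → sym (trans
         (∑-unique u (λ y → ⟦ does (σ y ≟A x) ⟧ * f y) (c (π x))
           (λ {y} _ y≢ → cong (λ b → ⟦ b ⟧ * f y)
              (dec-false (σ y ≟A x) (λ e → y≢ (trans (sym (πσ y)) (cong π e))))))
         (trans (cong (λ b → ⟦ b ⟧ * f (π x)) (dec-true (σ (π x) ≟A x) (σπ x)))
                (+-identityʳ (f (π x)))))) ⟩
  ∑ xs (λ x → ∑ xs (λ y → ⟦ does (σ y ≟A x) ⟧ * f y))
    ≡⟨ ∑-swap xs xs _ ⟩
  ∑ xs (λ y → ∑ xs (λ x → ⟦ does (σ y ≟A x) ⟧ * f y))
    ≡⟨ ∑-cong xs (λ y → trans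
         (∑-unique u (λ x → ⟦ does (σ y ≟A x) ⟧ * f y) (c (σ y))
           (λ {x} _ x≢ → cong (λ b → ⟦ b ⟧ * f y) (dec-false (σ y ≟A x) (λ e → x≢ (sym e)))))
         (trans (cong (λ b → ⟦ b ⟧ * f y) (dec-true (σ y ≟A σ y) refl)) (+-identityʳ (f y)))) ⟩
  ∑ xs f ∎
  where open ≡-Reasoning

∏ : ℕ → (ℕ → ℕ) → ℕ
∏ zero    f = 1
∏ (suc m) f = ∏ m f * f m

∏-cong : ∀ m {f g : ℕ → ℕ} → (∀ j → f j ≡ g j) → ∏ m f ≡ ∏ m g
∏-cong zero    h = refl
∏-cong (suc m) h = cong₂ _*_ (∏-cong m h) (h m)

-- Enumerations by sublists and tuples

concatMap-map : (f : A → B → D) (xs : List A) (ys : List B) →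
  concatMap (λ a → map (f a) ys) xs ≡ cartesianProductWith f xs ys
concatMap-map f []       ys = refl
concatMap-map f (x ∷ xs) ys = cong (map (f x) ys ++_) (concatMap-map f xs ys)

∑-listsOf : (m : ℕ) (xs : List A) (f : List A → ℕ) →
  ∑ (listsOf (suc m) xs) f ≡ ∑ xs (λ x → ∑ (listsOf m xs) (λ l → f (x ∷ l)))
∑-listsOf m xs f = trans (∑-concatMap _ xs f) (∑-cong xs (λ x → ∑-map (x ∷_) (listsOf m xs) f))

∈-listsOf⁺ : {xs : List A} → (∀ x → x ∈ xs) → ∀ l → l ∈ listsOf (length l) xs
∈-listsOf⁺ c []      = here refl
∈-listsOf⁺ {xs = xs} c (x ∷ l) =
  subst ((x ∷ l) ∈_) (sym (concatMap-map _∷_ xs (listsOf (length l) xs)))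
    (∈-cartesianProductWith⁺ _∷_ (c x) (∈-listsOf⁺ c l))

∈-listsOf⁻ : (m : ℕ) (xs : List A) {l : List A} → l ∈ listsOf m xs → length l ≡ m
∈-listsOf⁻ zero    xs (here refl) = refl
∈-listsOf⁻ (suc m) xs h
  with ∈-cartesianProductWith⁻ _∷_ xs (listsOf m xs) (subst (_ ∈_) (concatMap-map _∷_ xs (listsOf m xs)) h)
... | x , l , _ , hl , refl = cong suc (∈-listsOf⁻ m xs hl)

∈-sublists⁻ : (xs : List A) {S : List A} → S ∈ sublists xs → ∀ {x} → x ∈ S → x ∈ xs
∈-sublists⁻ [] (here refl) ()
∈-sublists⁻ (y ∷ xs) m x∈S with ∈-++⁻ (map (y ∷_) (sublists xs)) m
... | inj₂ m′ = there (∈-sublists⁻ xs m′ x∈S)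
... | inj₁ m′ with ∈-map⁻ (y ∷_) m′
...   | S , S∈ , refl with x∈S
...     | here refl = here refl
...     | there x∈  = there (∈-sublists⁻ xs S∈ x∈)

sublists-unique : {xs : List A} → Unique xs → Unique (sublists xs)
sublists-unique {xs = []}     _        = [] ∷ []
sublists-unique {xs = x ∷ xs} (x∉ ∷ u) =
  Unique.++⁺ (Unique.map⁺ (λ { refl → refl }) (sublists-unique u)) (sublists-unique u)
    (λ (m₁ , m₂) → disj m₁ m₂)
  where
  disj : ∀ {S} → S ∈ map (x ∷_) (sublists xs) → S ∈ sublists xs → ⊥
  disj m₁ m₂ with ∈-map⁻ (x ∷_) m₁
  ... | S , _ , refl = All.lookup x∉ (∈-sublists⁻ xs m₂ (here refl)) refl

filterᵇ-∈-sublists : (p : A → Bool) (xs : List A) → filterᵇ p xs ∈ sublists xs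
filterᵇ-∈-sublists p []       = here refl
filterᵇ-∈-sublists p (x ∷ xs) with p x
... | true  = ∈-++⁺ˡ (∈-map⁺ (x ∷_) (filterᵇ-∈-sublists p xs))
... | false = ∈-++⁺ʳ (map (x ∷_) (sublists xs)) (filterᵇ-∈-sublists p xs)

-- A sublist of a duplicate-free list is fixed by its members, which lets an element of `Grass` be
-- recovered from its membership predicate.
sublists-ext : {xs : List A} → Unique xs → ∀ {S S′} → S ∈ sublists xs → S′ ∈ sublists xs →
  (∀ {x} → x ∈ S → x ∈ S′) → (∀ {x} → x ∈ S′ → x ∈ S) → S ≡ S′
sublists-ext {xs = []} _ (here refl) (here refl) _ _ = refl
sublists-ext {xs = x ∷ xs} (x∉ ∷ u) m m′ f g
  with ∈-++⁻ (map (x ∷_) (sublists xs)) m | ∈-++⁻ (map (x ∷_) (sublists xs)) m′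
... | inj₂ n | inj₂ n′ = sublists-ext u n n′ f g
... | inj₁ n | inj₂ n′ with ∈-map⁻ (x ∷_) n
...   | S , _ , refl = ⊥-elim (All.lookup x∉ (∈-sublists⁻ xs n′ (f (here refl))) refl)
sublists-ext {xs = x ∷ xs} (x∉ ∷ u) m m′ f g
    | inj₂ n | inj₁ n′ with ∈-map⁻ (x ∷_) n′
...   | S , _ , refl = ⊥-elim (All.lookup x∉ (∈-sublists⁻ xs n (g (here refl))) refl)
sublists-ext {xs = x ∷ xs} (x∉ ∷ u) m m′ f g
    | inj₁ n | inj₁ n′ with ∈-map⁻ (x ∷_) n | ∈-map⁻ (x ∷_) n′
...   | S , S∈ , refl | S′ , S′∈ , refl =
  cong (x ∷_) (sublists-ext u S∈ S′∈ (tl S∈ f) (tl S′∈ g))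
  where
  tl : ∀ {R R′} → R ∈ sublists xs → (∀ {y} → y ∈ x ∷ R → y ∈ x ∷ R′) → ∀ {y} → y ∈ R → y ∈ R′
  tl R∈ h y∈ with h (there y∈)
  ... | here refl = ⊥-elim (All.lookup x∉ (∈-sublists⁻ xs R∈ y∈) refl)
  ... | there k   = k

-- Pascal's rule: sublists through the head `x` contribute, with `ℓ` lowered by one, exactly when
-- `p x` holds.
count-sublists : (p : A → Bool) (xs : List A) (ℓ : ℕ) →
  ∑ (sublists xs) (λ P → ⟦ does (length P ≟ ℓ) ∧ all p P ⟧) ≡ ∑ xs (λ x → ⟦ p x ⟧) C ℓ
count-sublists p []       zero    = refl
count-sublists p []       (suc ℓ) = refl
count-sublists p (x ∷ xs) ℓ =
  trans (∑-++ (map (x ∷_) (sublists xs)) (sublists xs) _)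
  (trans (cong₂ _+_ (∑-map (x ∷_) (sublists xs) _) (count-sublists p xs ℓ)) (step ℓ))
  where
  n = ∑ xs (λ y → ⟦ p y ⟧)
  step : ∀ ℓ → ∑ (sublists xs) (λ P → ⟦ does (suc (length P) ≟ ℓ) ∧ (p x ∧ all p P) ⟧) + n C ℓ
             ≡ (⟦ p x ⟧ + n) C ℓ
  step zero = trans (cong (_+ n C 0) (∑-zero (sublists xs))) refl
  step (suc ℓ) with p x
  ... | true  = trans (cong (_+ n C suc ℓ) (count-sublists p xs ℓ)) (nCk+nC[k+1]≡[n+1]C[k+1] n ℓ)
  ... | false = cong (_+ n C suc ℓ) (trans (∑-cong (sublists xs) (λ P → cong ⟦_⟧ (∧-z (does (length P ≟ ℓ))))) (∑-zero (sublists xs)))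
    where
    ∧-z : ∀ b → b ∧ false ≡ false
    ∧-z true  = refl
    ∧-z false = refl

-- Frames and Gaussian binomials in ℕ.

∏-head : ∀ m (f : ℕ → ℕ) → ∏ (suc m) f ≡ f 0 * ∏ m (λ j → f (suc j))
∏-head zero    f = trans (+-identityʳ (f 0)) (sym (*-identityʳ (f 0)))
∏-head (suc m) f = trans (cong (_* f (suc m)) (∏-head m f)) (*-assoc (f 0) _ _)

∏-split : ∀ j m (f : ℕ → ℕ) → ∏ (j + m) f ≡ ∏ j f * ∏ m (λ l → f (j + l))
∏-split j zero    f = trans (cong (λ n → ∏ n f) (+-identityʳ j)) (sym (*-identityʳ (∏ j f)))
∏-split j (suc m) f = trans (cong (λ n → ∏ n f) (+-suc j m))
  (trans (cong (_* f (j + m)) (∏-split j m f)) (*-assoc (∏ j f) _ _))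

module Gauss (q : ℕ) (1<q : 1 < q) where

  instance
    q-nonZero : NonZero q
    q-nonZero = >-nonZero (<-trans z<s 1<q)

  ^-pos : ∀ n → 0 < q ^ n
  ^-pos n = m^n>0 q n

  ^-injective : ∀ {m n} → q ^ m ≡ q ^ n → m ≡ n
  ^-injective {m} {n} e with m <? n | n <? m
  ... | yes m<n | _       = contradiction e (<⇒≢ (^-monoʳ-< q 1<q m<n))
  ... | no _    | yes n<m = contradiction (sym e) (<⇒≢ (^-monoʳ-< q 1<q n<m))
  ... | no m≮n  | no n≮m  = ≤-antisym (≮⇒≥ n≮m) (≮⇒≥ m≮n)

  ^-cancel-≤ : ∀ {m n} → q ^ m ≤ q ^ n → m ≤ n
  ^-cancel-≤ {m} {n} h with n <? m
  ... | yes n<m = contradiction (^-monoʳ-< q 1<q n<m) (≤⇒≯ h)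
  ... | no n≮m  = ≮⇒≥ n≮m

  -- The number of linearly independent m-tuples in a space of dimension a.
  frames : ℕ → ℕ → ℕ
  frames a m = ∏ m (λ j → q ^ a ∸ q ^ j)

  -- The left side counts `m`-tuples independent modulo a `c`-dimensional subspace of a space of
  -- dimension `c + a`: frames of the quotient, each vector lifted in `q ^ c` ways.
  frames-shift : ∀ c a m → ∏ m (λ j → q ^ (c + a) ∸ q ^ (c + j)) ≡ q ^ (c * m) * frames a m
  frames-shift c a zero    rewrite *-zeroʳ c = refl
  frames-shift c a (suc m) = begin
    ∏ m (λ j → q ^ (c + a) ∸ q ^ (c + j)) * (q ^ (c + a) ∸ q ^ (c + m))
      ≡⟨ cong₂ _*_ (frames-shift c a m)
           (trans (cong₂ _∸_ (^-distribˡ-+-* q c a) (^-distribˡ-+-* q c m))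
                  (sym (*-distribˡ-∸ (q ^ c) (q ^ a) (q ^ m)))) ⟩
    q ^ (c * m) * frames a m * (q ^ c * (q ^ a ∸ q ^ m))
      ≡⟨ lem (q ^ (c * m)) (frames a m) (q ^ c) (q ^ a ∸ q ^ m) ⟩
    (q ^ c * q ^ (c * m)) * (frames a m * (q ^ a ∸ q ^ m))
      ≡⟨ cong (_* frames a (suc m)) (sym (trans (cong (q ^_) (*-suc c m)) (^-distribˡ-+-* q c (c * m)))) ⟩
    q ^ (c * suc m) * frames a (suc m) ∎
    where
    open ≡-Reasoning
    lem : ∀ x y z w → x * y * (z * w) ≡ (z * x) * (y * w)
    lem = solve-∀

  frames-suc : ∀ n k → frames (suc n) (suc k) ≡ (q ^ suc n ∸ 1) * (q ^ k * frames n k)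
  frames-suc n k = trans (∏-head k (λ j → q ^ suc n ∸ q ^ j))
    (cong ((q ^ suc n ∸ 1) *_) (trans (frames-shift 1 n k) (cong (λ e → q ^ e * frames n k) (+-identityʳ k))))

  -- A frame of length `j + m` is a `j`-frame followed by an `m`-tuple independent modulo its span.
  frames-split : ∀ j a m → frames (j + a) (j + m) ≡ frames (j + a) j * (q ^ (j * m) * frames a m)
  frames-split j a m = trans (∏-split j m _) (cong (frames (j + a) j *_) (frames-shift j a m))

  frames-zero : ∀ {n k} → n < k → frames n k ≡ 0
  frames-zero {n} {suc k} (s≤s n≤k) with n ≟ k
  ... | yes refl = trans (cong (frames n n *_) (n∸n≡0 (q ^ n))) (*-zeroʳ (frames n n))
  ... | no n≢k   = cong (_* (q ^ n ∸ q ^ k)) (frames-zero (≤∧≢⇒< n≤k n≢k))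

  1<q^suc : ∀ k → 1 < q ^ suc k
  1<q^suc k = ^-monoʳ-< q 1<q {0} {suc k} z<s

  frames-pos : ∀ k → 0 < frames k k
  frames-pos zero    = z<s
  frames-pos (suc k) = subst (0 <_) (sym (frames-suc k k))
    (*-mono-< {0} {_} {0} (m<n⇒0<n∸m (1<q^suc k)) (*-mono-< {0} {_} {0} (^-pos k) (frames-pos k)))

  frames-cancel : ∀ k {x y} → x * frames k k ≡ y * frames k k → x ≡ y
  frames-cancel k {x} {y} = *-cancelʳ-≡ x y (frames k k) {{>-nonZero (frames-pos k)}}

  ^-cancel : ∀ k {x y} → x * q ^ k ≡ y * q ^ k → x ≡ y
  ^-cancel k {x} {y} = *-cancelʳ-≡ x y (q ^ k) {{>-nonZero (^-pos k)}}

  -- The Gaussian binomial, defined by the q-Pascal recursion so that it is an integer by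
  -- construction; `G-frames` replaces the quotient formula.
  G : ℕ → ℕ → ℕ
  G n       zero    = 1
  G zero    (suc k) = 0
  G (suc n) (suc k) = G n k + q ^ suc k * G n (suc k)

  ∸-telescope : ∀ {a b} → 1 ≤ b → b ≤ a → (b ∸ 1) + (a ∸ b) ≡ a ∸ 1
  ∸-telescope {a} {suc b} _ h = sym (trans (cong (_∸ 1) (sym (m+[n∸m]≡n h))) refl)

  -- Induction along the recursion of `G`: the factor `q ^ suc n ∸ 1` splits at `q ^ suc k`, and the
  -- two pieces come from the two summands. Splitting it at `q ^ d` instead yields `G-pascal`.
  G-frames : ∀ n k → G n k * frames k k ≡ frames n k
  G-frames n       zero    = refl
  G-frames zero    (suc k) = sym (frames-zero {0} {suc k} z<s)
  G-frames (suc n) (suc k) = begin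
    (G n k + q ^ suc k * G n (suc k)) * frames (suc k) (suc k)
      ≡⟨ lem₁ (G n k) (q ^ suc k) (G n (suc k)) (frames (suc k) (suc k)) ⟩
    G n k * frames (suc k) (suc k) + q ^ suc k * (G n (suc k) * frames (suc k) (suc k))
      ≡⟨ cong₂ _+_ (cong (G n k *_) (frames-suc k k)) (cong (q ^ suc k *_) (G-frames n (suc k))) ⟩
    G n k * ((q ^ suc k ∸ 1) * (q ^ k * frames k k)) + q ^ suc k * (frames n k * (q ^ n ∸ q ^ k))
      ≡⟨ lem₂ (G n k) (q ^ suc k ∸ 1) (q ^ k) (frames k k) q (frames n k) (q ^ n ∸ q ^ k) ⟩
    (q ^ suc k ∸ 1) * (q ^ k * (G n k * frames k k)) + q * (q ^ n ∸ q ^ k) * (q ^ k * frames n k)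
      ≡⟨ cong₂ _+_ (cong (λ z → (q ^ suc k ∸ 1) * (q ^ k * z)) (G-frames n k))
                   (cong (_* (q ^ k * frames n k)) (*-distribˡ-∸ q (q ^ n) (q ^ k))) ⟩
    (q ^ suc k ∸ 1) * (q ^ k * frames n k) + (q ^ suc n ∸ q ^ suc k) * (q ^ k * frames n k)
      ≡⟨ sym (*-distribʳ-+ (q ^ k * frames n k) (q ^ suc k ∸ 1) (q ^ suc n ∸ q ^ suc k)) ⟩
    ((q ^ suc k ∸ 1) + (q ^ suc n ∸ q ^ suc k)) * (q ^ k * frames n k)
      ≡⟨ final ⟩
    (q ^ suc n ∸ 1) * (q ^ k * frames n k)
      ≡⟨ sym (frames-suc n k) ⟩
    frames (suc n) (suc k) ∎
    where
    open ≡-Reasoning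
    lem₁ : ∀ a b c d → (a + b * c) * d ≡ a * d + b * (c * d)
    lem₁ = solve-∀
    lem₂ : ∀ a b c d e f g → a * (b * (c * d)) + e * c * (f * g) ≡ b * (c * (a * d)) + e * g * (c * f)
    lem₂ = solve-∀
    final : ((q ^ suc k ∸ 1) + (q ^ suc n ∸ q ^ suc k)) * (q ^ k * frames n k) ≡ (q ^ suc n ∸ 1) * (q ^ k * frames n k)
    -- Truncated subtraction telescopes only for `k ≤ n`; otherwise `frames n k` is zero on both
    -- sides.
    final with k ≤? n
    ... | yes k≤n = cong (_* (q ^ k * frames n k)) (∸-telescope (^-pos (suc k)) (^-monoʳ-≤ q (s≤s k≤n)))
    ... | no k≰n rewrite frames-zero (≰⇒> k≰n) | *-zeroʳ (q ^ k) =
      trans (*-zeroʳ ((q ^ suc k ∸ 1) + (q ^ suc n ∸ q ^ suc k))) (sym (*-zeroʳ (q ^ suc n ∸ 1)))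

  G-zero : ∀ {n k} → n < k → G n k ≡ 0
  G-zero {n} {k} h = frames-cancel k (trans (G-frames n k) (frames-zero h))

  G-self : ∀ n → G n n ≡ 1
  G-self n = frames-cancel n (trans (G-frames n n) (sym (+-identityʳ (frames n n))))

  -- The dual Pascal rule, stated at n = k + d to avoid n ∸ k.
  G-pascal : ∀ k d → G (suc (k + d)) (suc k) ≡ q ^ d * G (k + d) k + G (k + d) (suc k)
  G-pascal k d = frames-cancel (suc k) (begin
    G (suc n) (suc k) * frames (suc k) (suc k)
      ≡⟨ trans (G-frames (suc n) (suc k)) (frames-suc n k) ⟩
    (q ^ suc n ∸ 1) * (q ^ k * frames n k)
      ≡⟨ cong (_* (q ^ k * frames n k)) (sym (∸-telescope {q ^ suc n} {q ^ d} (^-pos d)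
           (^-monoʳ-≤ q (≤-trans (m≤n+m d k) (n≤1+n _))))) ⟩
    ((q ^ d ∸ 1) + (q ^ suc n ∸ q ^ d)) * (q ^ k * frames n k)
      ≡⟨ lem₁ (q ^ d ∸ 1) (q ^ suc n ∸ q ^ d) (q ^ k) (frames n k) ⟩
    frames n k * (q ^ k * (q ^ d ∸ 1)) + (q ^ suc n ∸ q ^ d) * (q ^ k * frames n k)
      ≡⟨ cong₂ _+_ (cong (frames n k *_) e₁) (cong (_* (q ^ k * frames n k)) e₂) ⟩
    frames n k * (q ^ n ∸ q ^ k) + q ^ d * (q ^ suc k ∸ 1) * (q ^ k * frames n k)
      ≡⟨ cong₂ (λ x y → x + q ^ d * (q ^ suc k ∸ 1) * (q ^ k * y)) (sym (G-frames n (suc k))) (sym (G-frames n k)) ⟩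
    G n (suc k) * frames (suc k) (suc k) + q ^ d * (q ^ suc k ∸ 1) * (q ^ k * (G n k * frames k k))
      ≡⟨ cong (_+ q ^ d * (q ^ suc k ∸ 1) * (q ^ k * (G n k * frames k k))) (cong (G n (suc k) *_) (frames-suc k k)) ⟩
    G n (suc k) * ((q ^ suc k ∸ 1) * (q ^ k * frames k k)) + q ^ d * (q ^ suc k ∸ 1) * (q ^ k * (G n k * frames k k))
      ≡⟨ lem₂ (G n (suc k)) (q ^ suc k ∸ 1) (q ^ k) (frames k k) (q ^ d) (G n k) ⟩
    (q ^ d * G n k + G n (suc k)) * ((q ^ suc k ∸ 1) * (q ^ k * frames k k))
      ≡⟨ cong ((q ^ d * G n k + G n (suc k)) *_) (sym (frames-suc k k)) ⟩
    (q ^ d * G n k + G n (suc k)) * frames (suc k) (suc k) ∎)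
    where
    open ≡-Reasoning
    n = k + d
    lem₁ : ∀ a b c d → (a + b) * (c * d) ≡ d * (c * a) + b * (c * d)
    lem₁ = solve-∀
    lem₂ : ∀ a b c d e f → a * (b * (c * d)) + e * b * (c * (f * d)) ≡ (e * f + a) * (b * (c * d))
    lem₂ = solve-∀
    e₁ : q ^ k * (q ^ d ∸ 1) ≡ q ^ n ∸ q ^ k
    e₁ = trans (*-distribˡ-∸ (q ^ k) (q ^ d) 1) (cong₂ _∸_ (sym (^-distribˡ-+-* q k d)) (*-identityʳ (q ^ k)))
    e₂ : q ^ suc n ∸ q ^ d ≡ q ^ d * (q ^ suc k ∸ 1)
    e₂ = sym (trans (*-distribˡ-∸ (q ^ d) (q ^ suc k) 1)
      (cong₂ _∸_ (trans (sym (^-distribˡ-+-* q d (suc k))) (cong (q ^_) (trans (+-suc d k) (cong suc (+-comm d k)))))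
                 (*-identityʳ (q ^ d))))

  -- Both sides count flags of subspaces of dimensions `j` and `j + m`. Multiplied by `frames j j`,
  -- `q ^ (j * m)` and `frames m m`, each becomes the number of frames of length `j + m`.
  G-trinomial : ∀ a j m → G (j + a) j * G a m ≡ G (j + a) (j + m) * G (j + m) j
  G-trinomial a j m = frames-cancel j (^-cancel (j * m) (frames-cancel m (begin
    G (j + a) j * G a m * frames j j * q ^ (j * m) * frames m m
      ≡⟨ lem₁ (G (j + a) j) (G a m) (frames j j) (q ^ (j * m)) (frames m m) ⟩
    (G (j + a) j * frames j j) * (q ^ (j * m) * (G a m * frames m m))
      ≡⟨ cong₂ (λ x y → x * (q ^ (j * m) * y)) (G-frames (j + a) j) (G-frames a m) ⟩
    frames (j + a) j * (q ^ (j * m) * frames a m)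
      ≡⟨ sym (frames-split j a m) ⟩
    frames (j + a) (j + m)
      ≡⟨ sym (G-frames (j + a) (j + m)) ⟩
    G (j + a) (j + m) * frames (j + m) (j + m)
      ≡⟨ cong (G (j + a) (j + m) *_) (frames-split j m m) ⟩
    G (j + a) (j + m) * (frames (j + m) j * (q ^ (j * m) * frames m m))
      ≡⟨ cong (λ z → G (j + a) (j + m) * (z * (q ^ (j * m) * frames m m))) (sym (G-frames (j + m) j)) ⟩
    G (j + a) (j + m) * (G (j + m) j * frames j j * (q ^ (j * m) * frames m m))
      ≡⟨ lem₂ (G (j + a) (j + m)) (G (j + m) j) (frames j j) (q ^ (j * m)) (frames m m) ⟩
    G (j + a) (j + m) * G (j + m) j * frames j j * q ^ (j * m) * frames m m ∎)))
    where
    open ≡-Reasoning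
    lem₁ : ∀ a b c d e → a * b * c * d * e ≡ (a * c) * (d * (b * e))
    lem₁ = solve-∀
    lem₂ : ∀ a b c d e → a * (b * c * (d * e)) ≡ a * b * c * d * e
    lem₂ = solve-∀

-- The embedding of ℕ into ℚ.

ι-≃ : ∀ n → toℚᵘ (ℕ→ℚ n) ℚᵘ.≃ mkℚᵘ (pos n) 0
ι-≃ n = ℚ.toℚᵘ-fromℚᵘ (mkℚᵘ (pos n) 0)

-- The normalisation inside `ℕ→ℚ` does not compute on a variable, so the comparison is made between
-- unnormalised fractions with denominator 1.
ι-+ : ∀ m n → ℕ→ℚ (m + n) ≡ ℕ→ℚ m ℚ.+ ℕ→ℚ n
ι-+ m n = ℚ.toℚᵘ-injective (ℚᵘ.≃-trans (ι-≃ (m + n)) (ℚᵘ.≃-sym (ℚᵘ.≃-trans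
  (ℚ.toℚᵘ-homo-+ (ℕ→ℚ m) (ℕ→ℚ n)) (ℚᵘ.≃-trans (ℚᵘ.+-cong (ι-≃ m) (ι-≃ n))
  (*≡* (cong (ℤ._* pos 1) (cong₂ ℤ._+_ (ℤ.*-identityʳ (pos m)) (ℤ.*-identityʳ (pos n)))))))))

ι-* : ∀ m n → ℕ→ℚ (m * n) ≡ ℕ→ℚ m ℚ.* ℕ→ℚ n
ι-* m n = ℚ.toℚᵘ-injective (ℚᵘ.≃-trans (ι-≃ (m * n)) (ℚᵘ.≃-sym (ℚᵘ.≃-trans
  (ℚ.toℚᵘ-homo-* (ℕ→ℚ m) (ℕ→ℚ n)) (ℚᵘ.≃-trans (ℚᵘ.*-cong (ι-≃ m) (ι-≃ n))
  (*≡* (cong (ℤ._* pos 1) (sym (ℤ.pos-* m n))))))))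

ι-injective : ∀ {m n} → ℕ→ℚ m ≡ ℕ→ℚ n → m ≡ n
ι-injective {m} {n} e with ℚᵘ.≃-trans (ℚᵘ.≃-sym (ι-≃ m)) (ℚᵘ.≃-trans (ℚ.toℚᵘ-cong e) (ι-≃ n))
... | *≡* h = ℤ.+-injective (trans (sym (ℤ.*-identityʳ (pos m))) (trans h (ℤ.*-identityʳ (pos n))))

ι-≢0 : ∀ {n} → n ≢ 0 → ℕ→ℚ n ≢ 0ℚ
ι-≢0 n≢0 e = n≢0 (ι-injective e)

ι-∸ : ∀ {m n} → n ≤ m → ℕ→ℚ m ℚ.- ℕ→ℚ n ≡ ℕ→ℚ (m ∸ n)
ι-∸ {m} {n} h = begin
  ℕ→ℚ m ℚ.- ℕ→ℚ n                     ≡⟨ cong (λ z → ℕ→ℚ z ℚ.- ℕ→ℚ n) (sym (m∸n+n≡m h)) ⟩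
  ℕ→ℚ (m ∸ n + n) ℚ.- ℕ→ℚ n           ≡⟨ cong (ℚ._- ℕ→ℚ n) (ι-+ (m ∸ n) n) ⟩
  ℕ→ℚ (m ∸ n) ℚ.+ ℕ→ℚ n ℚ.- ℕ→ℚ n     ≡⟨ ℚ.+-assoc (ℕ→ℚ (m ∸ n)) (ℕ→ℚ n) (ℚ.- ℕ→ℚ n) ⟩
  ℕ→ℚ (m ∸ n) ℚ.+ (ℕ→ℚ n ℚ.- ℕ→ℚ n)   ≡⟨ cong (ℕ→ℚ (m ∸ n) ℚ.+_) (ℚ.+-inverseʳ (ℕ→ℚ n)) ⟩
  ℕ→ℚ (m ∸ n) ℚ.+ 0ℚ                  ≡⟨ ℚ.+-identityʳ (ℕ→ℚ (m ∸ n)) ⟩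
  ℕ→ℚ (m ∸ n)                         ∎
  where open ≡-Reasoning

/ℚ-* : ∀ x {y} → y ≢ 0ℚ → (x /ℚ y) ℚ.* y ≡ x
/ℚ-* x {y} y≢0 with y ℚ.≟ 0ℚ
... | yes y≡0 = contradiction y≡0 y≢0
... | no y≢0′ = trans (ℚ.*-assoc x _ y)
  (trans (cong (x ℚ.*_) (ℚ.*-inverseˡ y {{ℚ.≢-nonZero y≢0′}})) (ℚ.*-identityʳ x))

ℚ-*-cancelʳ : ∀ {x y z} → z ≢ 0ℚ → x ℚ.* z ≡ y ℚ.* z → x ≡ y
ℚ-*-cancelʳ {x} {y} {z} z≢0 e = trans (inv x) (trans (cong (ℚ._* z⁻¹) e) (sym (inv y)))
  where
  z⁻¹ = ℚ.1/_ z {{ℚ.≢-nonZero z≢0}}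
  inv : ∀ w → w ≡ w ℚ.* z ℚ.* z⁻¹
  inv w = sym (trans (ℚ.*-assoc w z z⁻¹)
    (trans (cong (w ℚ.*_) (ℚ.*-inverseʳ z {{ℚ.≢-nonZero z≢0}})) (ℚ.*-identityʳ w)))

-- Rational sums and products.

sumℚ-++ : ∀ xs ys → sumℚ (xs ++ ys) ≡ sumℚ xs ℚ.+ sumℚ ys
sumℚ-++ []       ys = sym (ℚ.+-identityˡ (sumℚ ys))
sumℚ-++ (x ∷ xs) ys = trans (cong (x ℚ.+_) (sumℚ-++ xs ys)) (sym (ℚ.+-assoc x _ _))

prodℚ-++ : ∀ xs ys → prodℚ (xs ++ ys) ≡ prodℚ xs ℚ.* prodℚ ys
prodℚ-++ []       ys = sym (ℚ.*-identityˡ (prodℚ ys))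
prodℚ-++ (x ∷ xs) ys = trans (cong (x ℚ.*_) (prodℚ-++ xs ys)) (sym (ℚ.*-assoc x _ _))

-- `sumTo n` is `∑< (suc n)` by definition; the strict bound also admits the empty sum, needed when
-- the indices below `r` are split off.
∑< : ℕ → (ℕ → ℚ) → ℚ
∑< n f = sumℚ (map f (upTo n))

∑<-suc : ∀ n f → ∑< (suc n) f ≡ ∑< n f ℚ.+ f n
∑<-suc n f = trans (cong (λ l → sumℚ (map f l)) (sym (upTo-∷ʳ n)))
  (trans (cong sumℚ (map-++ f (upTo n) (n ∷ [])))
  (trans (sumℚ-++ (map f (upTo n)) (f n ∷ [])) (cong (∑< n f ℚ.+_) (ℚ.+-identityʳ (f n)))))

∑<-cong : ∀ n {f g : ℕ → ℚ} → (∀ j → j < n → f j ≡ g j) → ∑< n f ≡ ∑< n g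
∑<-cong zero    h = refl
∑<-cong (suc n) {f} {g} h = trans (∑<-suc n f)
  (trans (cong₂ ℚ._+_ (∑<-cong n (λ j j<n → h j (m<n⇒m<1+n j<n))) (h n (n<1+n n))) (sym (∑<-suc n g)))

∑<-zero : ∀ n → ∑< n (λ _ → 0ℚ) ≡ 0ℚ
∑<-zero zero    = refl
∑<-zero (suc n) = trans (∑<-suc n _) (trans (ℚ.+-identityʳ _) (∑<-zero n))

∑<-split : ∀ r m f → ∑< (r + m) f ≡ ∑< r f ℚ.+ ∑< m (λ j → f (r + j))
∑<-split r zero    f = trans (cong (λ n → ∑< n f) (+-identityʳ r)) (sym (ℚ.+-identityʳ _))
∑<-split r (suc m) f = trans (cong (λ n → ∑< n f) (+-suc r m)) (trans (∑<-suc (r + m) f)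
  (trans (cong (ℚ._+ f (r + m)) (∑<-split r m f)) (trans (ℚ.+-assoc (∑< r f) (∑< m (λ j → f (r + j))) (f (r + m)))
  (cong (∑< r f ℚ.+_) (sym (∑<-suc m (λ j → f (r + j))))))))

∑ℚ : List A → (A → ℚ) → ℚ
∑ℚ xs f = sumℚ (map f xs)

∑ℚ-cong : (xs : List A) {f g : A → ℚ} → (∀ x → f x ≡ g x) → ∑ℚ xs f ≡ ∑ℚ xs g
∑ℚ-cong []       h = refl
∑ℚ-cong (x ∷ xs) h = cong₂ ℚ._+_ (h x) (∑ℚ-cong xs h)

∑ℚ-*ʳ : (xs : List A) (f : A → ℚ) (c : ℚ) → ∑ℚ xs (λ x → f x ℚ.* c) ≡ ∑ℚ xs f ℚ.* c
∑ℚ-*ʳ []       f c = sym (ℚ.*-zeroˡ c)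
∑ℚ-*ʳ (x ∷ xs) f c = trans (cong (f x ℚ.* c ℚ.+_) (∑ℚ-*ʳ xs f c)) (sym (ℚ.*-distribʳ-+ c (f x) _))

∑ℚ-*ˡ : (xs : List A) (c : ℚ) (f : A → ℚ) → ∑ℚ xs (λ x → c ℚ.* f x) ≡ c ℚ.* ∑ℚ xs f
∑ℚ-*ˡ xs c f = trans (∑ℚ-cong xs (λ x → ℚ.*-comm c (f x))) (trans (∑ℚ-*ʳ xs f c) (ℚ.*-comm _ c))

∑ℚ-+ : (xs : List A) (f g : A → ℚ) → ∑ℚ xs (λ x → f x ℚ.+ g x) ≡ ∑ℚ xs f ℚ.+ ∑ℚ xs g
∑ℚ-+ []       f g = refl
∑ℚ-+ (x ∷ xs) f g = trans (cong ((f x ℚ.+ g x) ℚ.+_) (∑ℚ-+ xs f g))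
  (ℚ-Solver.solve 4 (λ a b c d → (a :+ b) :+ (c :+ d) := (a :+ c) :+ (b :+ d)) refl (f x) (g x) (∑ℚ xs f) (∑ℚ xs g))

∑<-∑ℚ-swap : ∀ n (xs : List A) (f : ℕ → A → ℚ) →
  ∑< n (λ i → ∑ℚ xs (f i)) ≡ ∑ℚ xs (λ x → ∑< n (λ i → f i x))
∑<-∑ℚ-swap zero    []       f = refl
∑<-∑ℚ-swap zero    (x ∷ xs) f = trans (∑<-∑ℚ-swap zero xs f) (sym (ℚ.+-identityˡ _))
∑<-∑ℚ-swap (suc n) xs       f = trans (∑<-suc n _) (trans (cong (ℚ._+ ∑ℚ xs (f n)) (∑<-∑ℚ-swap n xs f))
  (trans (sym (∑ℚ-+ xs (λ x → ∑< n (λ i → f i x)) (f n)))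
         (∑ℚ-cong xs (λ x → sym (∑<-suc n (λ i → f i x))))))

ι-∑ : (xs : List A) (f : A → ℕ) → ℕ→ℚ (∑ xs f) ≡ ∑ℚ xs (λ x → ℕ→ℚ (f x))
ι-∑ []       f = refl
ι-∑ (x ∷ xs) f = trans (ι-+ (f x) (∑ xs f)) (cong (ℕ→ℚ (f x) ℚ.+_) (ι-∑ xs f))

-- Denominators are cleared one factor at a time, so the product of quotients in `gaussℕ` can be
-- compared with `frames` in ℕ.
prodℚ-∏ : ∀ b (f : ℕ → ℚ) (x y : ℕ → ℕ) → (∀ j → j < b → f j ℚ.* ℕ→ℚ (y j) ≡ ℕ→ℚ (x j)) →
  prodℚ (map f (upTo b)) ℚ.* ℕ→ℚ (∏ b y) ≡ ℕ→ℚ (∏ b x)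
prodℚ-∏ zero    f x y h = refl
prodℚ-∏ (suc b) f x y h = begin
  prodℚ (map f (upTo (suc b))) ℚ.* ℕ→ℚ (∏ b y * y b)
    ≡⟨ cong₂ ℚ._*_
         (trans (cong (λ l → prodℚ (map f l)) (sym (upTo-∷ʳ b)))
         (trans (cong prodℚ (map-++ f (upTo b) (b ∷ [])))
         (trans (prodℚ-++ (map f (upTo b)) (f b ∷ [])) (cong (p ℚ.*_) (ℚ.*-identityʳ (f b))))))
         (ι-* (∏ b y) (y b)) ⟩
  (p ℚ.* f b) ℚ.* (ℕ→ℚ (∏ b y) ℚ.* ℕ→ℚ (y b))
    ≡⟨ ℚ-Solver.solve 4 (λ s t u v → (s :* t) :* (u :* v) := (s :* u) :* (t :* v)) refl p (f b) (ℕ→ℚ (∏ b y)) (ℕ→ℚ (y b)) ⟩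
  (p ℚ.* ℕ→ℚ (∏ b y)) ℚ.* (f b ℚ.* ℕ→ℚ (y b))
    ≡⟨ cong₂ ℚ._*_ (prodℚ-∏ b f x y (λ j j<b → h j (m<n⇒m<1+n j<b))) (h b (n<1+n b)) ⟩
  ℕ→ℚ (∏ b x) ℚ.* ℕ→ℚ (x b)
    ≡⟨ sym (ι-* (∏ b x) (x b)) ⟩
  ℕ→ℚ (∏ b x * x b) ∎
  where
  open ≡-Reasoning
  p = prodℚ (map f (upTo b))

-- Möbius inversion with Gaussian coefficients.

module Gaussℚ (q : ℕ) (1<q : 1 < q) where
  open Gauss q 1<q

  gaussℕ≡G : ∀ a b → gaussℕ q a b ≡ ℕ→ℚ (G a b)
  gaussℕ≡G a b with a <? b
  ... | yes a<b = cong ℕ→ℚ (sym (G-zero a<b))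
  ... | no a≮b  = ℚ-*-cancelʳ (ι-≢0 (>⇒≢ (frames-pos b)))
    (trans (prodℚ-∏ b _ (λ j → q ^ a ∸ q ^ j) (λ j → q ^ b ∸ q ^ j) factor)
    (trans (cong ℕ→ℚ (sym (G-frames a b))) (ι-* (G a b) (frames b b))))
    where
    factor : ∀ j → j < b → ((ℕ→ℚ (q ^ a) ℚ.- ℕ→ℚ (q ^ j)) /ℚ (ℕ→ℚ (q ^ b) ℚ.- ℕ→ℚ (q ^ j))) ℚ.* ℕ→ℚ (q ^ b ∸ q ^ j) ≡ ℕ→ℚ (q ^ a ∸ q ^ j)
    -- `j < b ≤ a` makes both truncated differences genuine, and `j < b` makes the denominator
    -- nonzero.
    factor j j<b = trans
      (cong₂ (λ x y → (x /ℚ y) ℚ.* ℕ→ℚ (q ^ b ∸ q ^ j))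
        (ι-∸ (^-monoʳ-≤ q (≤-trans (<⇒≤ j<b) (≮⇒≥ a≮b)))) (ι-∸ (^-monoʳ-≤ q (<⇒≤ j<b))))
      (/ℚ-* (ℕ→ℚ (q ^ a ∸ q ^ j)) (ι-≢0 (>⇒≢ (m<n⇒0<n∸m (^-monoʳ-< q 1<q j<b)))))

  -- The Möbius function of the subspace lattice on intervals of length d.
  coefficient : ℕ → ℚ
  coefficient d = sign d ℚ.* ℕ→ℚ (q ^ (d C 2))

  -- The binomial exponent grows by `d`, since `suc d C 2` equals `d + d C 2`, while the sign flips.
  coefficient-suc : ∀ d → coefficient (suc d) ≡ ℚ.- (coefficient d ℚ.* ℕ→ℚ (q ^ d))
  coefficient-suc d = trans (cong ((ℚ.- sign d) ℚ.*_) (trans (cong ℕ→ℚ e) (ι-* (q ^ d) (q ^ (d C 2)))))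
    (ℚ-Solver.solve 3 (λ s t u → (:- s) :* (t :* u) := :- (s :* u :* t)) refl (sign d) (ℕ→ℚ (q ^ d)) (ℕ→ℚ (q ^ (d C 2))))
    where
    e : q ^ (suc d C 2) ≡ q ^ d * q ^ (d C 2)
    e = trans (cong (q ^_) (trans (sym (nCk+nC[k+1]≡[n+1]C[k+1] d 1)) (cong (_+ d C 2) (nC1≡n d))))
              (^-distribˡ-+-* q d (d C 2))

  alternating : ℕ → ℕ → ℚ
  alternating n j = coefficient (n ∸ j) ℚ.* ℕ→ℚ (G n j)

  -- Partial alternating sums telescope by the dual Pascal rule.
  alternating-partial : ∀ J d → ∑< (suc J) (alternating (suc (J + d))) ≡ coefficient (suc d) ℚ.* ℕ→ℚ (G (J + d) J)
  alternating-partial zero    d = ℚ.+-identityʳ (coefficient (suc d) ℚ.* ℕ→ℚ 1)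
  alternating-partial (suc J) d = begin
    ∑< (suc (suc J)) (alternating (suc n))
      ≡⟨ ∑<-suc (suc J) (alternating (suc n)) ⟩
    ∑< (suc J) (alternating (suc n)) ℚ.+ alternating (suc n) (suc J)
      ≡⟨ cong₂ ℚ._+_ IH last ⟩
    coefficient (suc (suc d)) ℚ.* g₁ ℚ.+ coefficient (suc d) ℚ.* (ℕ→ℚ (q ^ suc d) ℚ.* g₁ ℚ.+ g₂)
      ≡⟨ cong (λ z → z ℚ.* g₁ ℚ.+ coefficient (suc d) ℚ.* (ℕ→ℚ (q ^ suc d) ℚ.* g₁ ℚ.+ g₂)) (coefficient-suc (suc d)) ⟩
    (ℚ.- (coefficient (suc d) ℚ.* ℕ→ℚ (q ^ suc d))) ℚ.* g₁ ℚ.+ coefficient (suc d) ℚ.* (ℕ→ℚ (q ^ suc d) ℚ.* g₁ ℚ.+ g₂)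
      ≡⟨ ℚ-Solver.solve 4 (λ c p x y → (:- (c :* p)) :* x :+ c :* (p :* x :+ y) := c :* y) refl (coefficient (suc d)) (ℕ→ℚ (q ^ suc d)) g₁ g₂ ⟩
    coefficient (suc d) ℚ.* g₂ ∎
    where
    open ≡-Reasoning
    n = suc J + d
    g₁ = ℕ→ℚ (G n J)
    g₂ = ℕ→ℚ (G n (suc J))
    e : J + suc d ≡ n
    e = +-suc J d
    IH : ∑< (suc J) (alternating (suc n)) ≡ coefficient (suc (suc d)) ℚ.* g₁
    IH = subst (λ m → ∑< (suc J) (alternating (suc m)) ≡ coefficient (suc (suc d)) ℚ.* ℕ→ℚ (G m J)) e
           (alternating-partial J (suc d))
    last : alternating (suc n) (suc J) ≡ coefficient (suc d) ℚ.* (ℕ→ℚ (q ^ suc d) ℚ.* g₁ ℚ.+ g₂)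
    last = cong₂ ℚ._*_
      (cong coefficient (trans (cong (_∸ J) (sym e)) (m+n∸m≡n J (suc d))))
      (trans (cong ℕ→ℚ (subst (λ m → G (suc m) (suc J) ≡ q ^ suc d * G m J + G m (suc J)) e (G-pascal J (suc d))))
      (trans (ι-+ (q ^ suc d * G n J) (G n (suc J))) (cong (ℚ._+ g₂) (ι-* (q ^ suc d) (G n J)))))

  -- For positive `n` the partial sum with `d = 0` omits only the top term; it equals minus one, and
  -- the top term equals one.
  alternating-sum : ∀ n → ∑< (suc n) (alternating n) ≡ ℕ→ℚ ⟦ does (n ≟ 0) ⟧
  alternating-sum zero    = refl
  alternating-sum (suc n) = begin
    ∑< (suc (suc n)) (alternating (suc n))
      ≡⟨ ∑<-suc (suc n) (alternating (suc n)) ⟩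
    ∑< (suc n) (alternating (suc n)) ℚ.+ alternating (suc n) (suc n)
      ≡⟨ cong₂ ℚ._+_
           (subst (λ m → ∑< (suc n) (alternating (suc m)) ≡ coefficient 1 ℚ.* ℕ→ℚ (G m n)) (+-identityʳ n) (alternating-partial n 0))
           (cong₂ (λ x y → coefficient x ℚ.* ℕ→ℚ y) (n∸n≡0 n) (G-self (suc n))) ⟩
    coefficient 1 ℚ.* ℕ→ℚ (G n n) ℚ.+ coefficient 0 ℚ.* 1ℚ
      ≡⟨ cong (λ y → coefficient 1 ℚ.* ℕ→ℚ y ℚ.+ coefficient 0 ℚ.* 1ℚ) (G-self n) ⟩
    0ℚ ∎
    where open ≡-Reasoning

  -- By `G-trinomial` the factor `G M n` is common to all terms and leaves the alternating sum; when
  -- `n` is zero that factor is 1.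
  inversion₀ : ∀ M n → n ≤ M →
    ∑< (suc n) (λ j → coefficient (n ∸ j) ℚ.* gaussℕ q (M ∸ j) (n ∸ j) ℚ.* ℕ→ℚ (G M j)) ≡ ℕ→ℚ ⟦ does (n ≟ 0) ⟧
  inversion₀ M n n≤M = begin
    ∑< (suc n) (λ j → coefficient (n ∸ j) ℚ.* gaussℕ q (M ∸ j) (n ∸ j) ℚ.* ℕ→ℚ (G M j))
      ≡⟨ ∑<-cong (suc n) (λ j j<sn → term j (s≤s⁻¹ j<sn)) ⟩
    ∑< (suc n) (λ j → alternating n j ℚ.* ℕ→ℚ (G M n))
      ≡⟨ ∑ℚ-*ʳ (upTo (suc n)) (alternating n) (ℕ→ℚ (G M n)) ⟩
    ∑< (suc n) (alternating n) ℚ.* ℕ→ℚ (G M n)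
      ≡⟨ cong (ℚ._* ℕ→ℚ (G M n)) (alternating-sum n) ⟩
    ℕ→ℚ ⟦ does (n ≟ 0) ⟧ ℚ.* ℕ→ℚ (G M n)
      ≡⟨ last n ⟩
    ℕ→ℚ ⟦ does (n ≟ 0) ⟧ ∎
    where
    open ≡-Reasoning
    last : ∀ n → ℕ→ℚ ⟦ does (n ≟ 0) ⟧ ℚ.* ℕ→ℚ (G M n) ≡ ℕ→ℚ ⟦ does (n ≟ 0) ⟧
    last zero    = refl
    last (suc n) = ℚ.*-zeroˡ (ℕ→ℚ (G M (suc n)))
    tri : ∀ j → j ≤ n → G (M ∸ j) (n ∸ j) * G M j ≡ G n j * G M n
    tri j j≤n = trans (*-comm (G (M ∸ j) (n ∸ j)) (G M j)) (trans
      (subst₂ (λ M′ n′ → G M′ j * G (M ∸ j) (n ∸ j) ≡ G M′ n′ * G n′ j)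
        (m+[n∸m]≡n (≤-trans j≤n n≤M)) (m+[n∸m]≡n j≤n) (G-trinomial (M ∸ j) j (n ∸ j)))
      (*-comm (G M n) (G n j)))
    term : ∀ j → j ≤ n → coefficient (n ∸ j) ℚ.* gaussℕ q (M ∸ j) (n ∸ j) ℚ.* ℕ→ℚ (G M j) ≡ alternating n j ℚ.* ℕ→ℚ (G M n)
    term j j≤n = trans (cong (λ z → coefficient (n ∸ j) ℚ.* z ℚ.* ℕ→ℚ (G M j)) (gaussℕ≡G (M ∸ j) (n ∸ j)))
      (trans (ℚ.*-assoc (coefficient (n ∸ j)) _ _)
      (trans (cong (coefficient (n ∸ j) ℚ.*_) (trans (sym (ι-* (G (M ∸ j) (n ∸ j)) (G M j)))
               (trans (cong ℕ→ℚ (tri j j≤n)) (ι-* (G n j) (G M n)))))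
             (sym (ℚ.*-assoc (coefficient (n ∸ j)) _ _))))

  -- `H i` stands for the number of `i`-dimensional subspaces above a fixed `r`-dimensional one.
  -- Terms with `i < r` vanish, and `i = r + j` reduces the rest to `inversion₀` in the quotient of
  -- dimension `N ∸ r`. If `r` exceeds `ρ`, nothing remains.
  inversion : ∀ N ρ r → ρ ≤ N → (H : ℕ → ℕ) → (∀ i → i < r → H i ≡ 0) → (∀ j → H (r + j) ≡ G (N ∸ r) j) →
    ∑< (suc ρ) (λ i → coefficient (ρ ∸ i) ℚ.* gaussℕ q (N ∸ i) (ρ ∸ i) ℚ.* ℕ→ℚ (H i)) ≡ ℕ→ℚ ⟦ does (r ≟ ρ) ⟧
  inversion N ρ r ρ≤N H H< H≥ with r ≤? ρ
  ... | no r≰ρ = trans (∑<-cong (suc ρ) (λ i i<sρ → trans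
          (cong (λ z → coefficient (ρ ∸ i) ℚ.* gaussℕ q (N ∸ i) (ρ ∸ i) ℚ.* ℕ→ℚ z) (H< i (≤-trans i<sρ (≰⇒> r≰ρ))))
          (ℚ.*-zeroʳ (coefficient (ρ ∸ i) ℚ.* gaussℕ q (N ∸ i) (ρ ∸ i)))))
      (trans (∑<-zero (suc ρ)) (cong (λ b → ℕ→ℚ ⟦ b ⟧) (sym (dec-false (r ≟ ρ) (λ e → r≰ρ (≤-reflexive e))))))
  ... | yes r≤ρ = begin
    ∑< (suc ρ) f
      ≡⟨ cong (λ m → ∑< m f) (sym (trans (+-suc r (ρ ∸ r)) (cong suc (m+[n∸m]≡n r≤ρ)))) ⟩
    ∑< (r + suc n) f
      ≡⟨ ∑<-split r (suc n) f ⟩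
    ∑< r f ℚ.+ ∑< (suc n) (λ j → f (r + j))
      ≡⟨ cong₂ ℚ._+_
           (trans (∑<-cong r (λ i i<r → trans
              (cong (λ z → coefficient (ρ ∸ i) ℚ.* gaussℕ q (N ∸ i) (ρ ∸ i) ℚ.* ℕ→ℚ z) (H< i i<r))
              (ℚ.*-zeroʳ (coefficient (ρ ∸ i) ℚ.* gaussℕ q (N ∸ i) (ρ ∸ i)))))
              (∑<-zero r))
           (∑<-cong (suc n) (λ j _ → term j)) ⟩
    0ℚ ℚ.+ ∑< (suc n) (λ j → coefficient (n ∸ j) ℚ.* gaussℕ q (N ∸ r ∸ j) (n ∸ j) ℚ.* ℕ→ℚ (G (N ∸ r) j))
      ≡⟨ ℚ.+-identityˡ _ ⟩
    ∑< (suc n) (λ j → coefficient (n ∸ j) ℚ.* gaussℕ q (N ∸ r ∸ j) (n ∸ j) ℚ.* ℕ→ℚ (G (N ∸ r) j))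
      ≡⟨ inversion₀ (N ∸ r) n (∸-monoˡ-≤ r ρ≤N) ⟩
    ℕ→ℚ ⟦ does (n ≟ 0) ⟧
      ≡⟨ cong (λ b → ℕ→ℚ ⟦ b ⟧) (bool-ext
           (λ h → dec-true (r ≟ ρ) (≤-antisym r≤ρ (m∸n≡0⇒m≤n (does-sound (n ≟ 0) h))))
           (λ h → dec-true (n ≟ 0) (m≤n⇒m∸n≡0 (≤-reflexive (sym (does-sound (r ≟ ρ) h)))))) ⟩
    ℕ→ℚ ⟦ does (r ≟ ρ) ⟧ ∎
    where
    open ≡-Reasoning
    n = ρ ∸ r
    f : ℕ → ℚ
    f i = coefficient (ρ ∸ i) ℚ.* gaussℕ q (N ∸ i) (ρ ∸ i) ℚ.* ℕ→ℚ (H i)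
    term : ∀ j → f (r + j) ≡ coefficient (n ∸ j) ℚ.* gaussℕ q (N ∸ r ∸ j) (n ∸ j) ℚ.* ℕ→ℚ (G (N ∸ r) j)
    term j = trans
      (cong₂ (λ d M → coefficient d ℚ.* gaussℕ q M d ℚ.* ℕ→ℚ (H (r + j))) (sym (∸-+-assoc ρ r j)) (sym (∸-+-assoc N r j)))
      (cong (λ h → coefficient (n ∸ j) ℚ.* gaussℕ q (N ∸ r ∸ j) (n ∸ j) ℚ.* ℕ→ℚ h) (H≥ j))

-- Linear algebra over the finite field.

Fin-nontrivial : ∀ {n} {x y : Fin n} → x ≢ y → 1 < n
Fin-nontrivial {zero}        {()}
Fin-nontrivial {suc zero}    {Fin.zero} {Fin.zero} x≢y = ⊥-elim (x≢y refl)
Fin-nontrivial {suc (suc n)} _ = s≤s (s≤s z≤n)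

module Linear {q : ℕ} (F : FiniteField q) where
  open FiniteField F renaming (_+_ to _+ᶠ_; _*_ to _*ᶠ_; -_ to -ᶠ_)
  open Over F

  1<q : 1 < q
  1<q = Fin-nontrivial 0≢1

  open Gauss q 1<q public

  private
    fieldRing : CommutativeRing _ _
    fieldRing = record { isCommutativeRing = isCommutativeRing }

    module R = CommutativeRing fieldRing
    open import Algebra.Solver.Ring.NaturalCoefficients.Default R.commutativeSemiring using (solve) renaming (_:=_ to _⊜_; _:+_ to _⊞_; _:*_ to _⊠_)

  infixl 6 _⊕_
  infixl 7 _·_

  _⊕_ : ∀ {N} → Pt N → Pt N → Pt N
  _⊕_ = V.zipWith _+ᶠ_

  _·_ : ∀ {N} → Fin q → Pt N → Pt N
  c · v = V.map (c *ᶠ_) v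

  private
    -- These are the coordinates of the vector identities below. The solver works in commutative
    -- semirings, where negatives are opaque, so each cancellation is supplied separately.
    f₁ : ∀ x g → x +ᶠ 0# *ᶠ g ≡ x
    f₁ x g = trans (cong (x +ᶠ_) (R.zeroˡ g)) (R.+-identityʳ x)

    f₂ : ∀ a c d x y g → a *ᶠ (x +ᶠ c *ᶠ g) +ᶠ (y +ᶠ d *ᶠ g) ≡ (a *ᶠ x +ᶠ y) +ᶠ (a *ᶠ c +ᶠ d) *ᶠ g
    f₂ = solve 6 (λ a c d x y g → a ⊠ (x ⊞ c ⊠ g) ⊞ (y ⊞ d ⊠ g) ⊜ (a ⊠ x ⊞ y) ⊞ (a ⊠ c ⊞ d) ⊠ g) refl

    f₃ : ∀ c d x g → c +ᶠ d ≡ 0# → (x +ᶠ c *ᶠ g) +ᶠ d *ᶠ g ≡ x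
    f₃ c d x g e = trans (solve 4 (λ c d x g → (x ⊞ c ⊠ g) ⊞ d ⊠ g ⊜ x ⊞ (c ⊞ d) ⊠ g) refl c d x g)
      (trans (cong (λ z → x +ᶠ z *ᶠ g) e) (f₁ x g))

    f₄ : ∀ c d x g → (-ᶠ 1#) *ᶠ (x +ᶠ c *ᶠ g) +ᶠ (x +ᶠ d *ᶠ g) ≡ (d +ᶠ (-ᶠ 1#) *ᶠ c) *ᶠ g
    f₄ c d x g = trans (cong (λ z → (-ᶠ 1#) *ᶠ (x +ᶠ c *ᶠ g) +ᶠ (z +ᶠ d *ᶠ g)) (sym (R.*-identityˡ x)))
      (trans (solve 6 (λ n o c d x g → n ⊠ (x ⊞ c ⊠ g) ⊞ (o ⊠ x ⊞ d ⊠ g) ⊜ (d ⊞ n ⊠ c) ⊠ g ⊞ (n ⊞ o) ⊠ x)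
                refl (-ᶠ 1#) 1# c d x g)
      (trans (cong (λ z → (d +ᶠ (-ᶠ 1#) *ᶠ c) *ᶠ g +ᶠ z *ᶠ x) (R.-‿inverseˡ 1#)) (f₁ _ x)))

    f₅ : ∀ g → g +ᶠ (-ᶠ 1#) *ᶠ g ≡ 0#
    f₅ g = trans (cong (_+ᶠ (-ᶠ 1#) *ᶠ g) (sym (trans (R.+-identityˡ (1# *ᶠ g)) (R.*-identityˡ g))))
      (f₃ 1# (-ᶠ 1#) 0# g (R.-‿inverseʳ 1#))

    f₆ : ∀ c d g → c *ᶠ (d *ᶠ g) +ᶠ 0# ≡ (d *ᶠ c) *ᶠ g
    f₆ c d g = trans (R.+-identityʳ _) (solve 3 (λ c d g → c ⊠ (d ⊠ g) ⊜ (d ⊠ c) ⊠ g) refl c d g)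

    f₇ : ∀ d c → d +ᶠ (-ᶠ 1#) *ᶠ c ≡ 0# → c ≡ d
    f₇ d c e = trans (sym (R.+-identityˡ c)) (trans (cong (_+ᶠ c) (sym e))
      (trans (cong (d +ᶠ (-ᶠ 1#) *ᶠ c +ᶠ_) (sym (R.*-identityˡ c))) (f₃ (-ᶠ 1#) 1# d c (R.-‿inverseˡ 1#))))

  ⊕-0· : ∀ {N} (x g : Pt N) → x ⊕ 0# · g ≡ x
  ⊕-0· []       []       = refl
  ⊕-0· (x ∷ xs) (g ∷ gs) = cong₂ _∷_ (f₁ x g) (⊕-0· xs gs)

  ⊕-combine : ∀ {N} a c d (x y g : Pt N) → a · (x ⊕ c · g) ⊕ (y ⊕ d · g) ≡ (a · x ⊕ y) ⊕ (a *ᶠ c +ᶠ d) · g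
  ⊕-combine a c d []       []       []       = refl
  ⊕-combine a c d (x ∷ xs) (y ∷ ys) (g ∷ gs) = cong₂ _∷_ (f₂ a c d x y g) (⊕-combine a c d xs ys gs)

  ⊕-neg : ∀ {N} (g : Pt N) → g ⊕ (-ᶠ 1#) · g ≡ zeroV N
  ⊕-neg []       = refl
  ⊕-neg (g ∷ gs) = cong₂ _∷_ (f₅ g) (⊕-neg gs)

  ⊕-difference : ∀ {N} c d (x g : Pt N) → (-ᶠ 1#) · (x ⊕ c · g) ⊕ (x ⊕ d · g) ≡ (d +ᶠ (-ᶠ 1#) *ᶠ c) · g
  ⊕-difference c d []       []       = refl
  ⊕-difference c d (x ∷ xs) (g ∷ gs) = cong₂ _∷_ (f₄ c d x g) (⊕-difference c d xs gs)

  ⊕-cancel : ∀ {N} c (x g : Pt N) → (x ⊕ c · g) ⊕ (-ᶠ c) · g ≡ x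
  ⊕-cancel c []       []       = refl
  ⊕-cancel c (x ∷ xs) (g ∷ gs) = cong₂ _∷_ (f₃ c (-ᶠ c) x g (R.-‿inverseʳ c)) (⊕-cancel c xs gs)

  ⊕-cancel′ : ∀ {N} c (x g : Pt N) → (x ⊕ (-ᶠ c) · g) ⊕ c · g ≡ x
  ⊕-cancel′ c []       []       = refl
  ⊕-cancel′ c (x ∷ xs) (g ∷ gs) = cong₂ _∷_ (f₃ (-ᶠ c) c x g (R.-‿inverseˡ c)) (⊕-cancel′ c xs gs)

  ⊕-comm : ∀ {N} (x y : Pt N) → x ⊕ y ≡ y ⊕ x
  ⊕-comm []       []       = refl
  ⊕-comm (x ∷ xs) (y ∷ ys) = cong₂ _∷_ (R.+-comm x y) (⊕-comm xs ys)

  ·-assoc-⊕0 : ∀ {N} c d (g : Pt N) → c · (d · g) ⊕ zeroV N ≡ (d *ᶠ c) · g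
  ·-assoc-⊕0 c d []       = refl
  ·-assoc-⊕0 c d (g ∷ gs) = cong₂ _∷_ (f₆ c d g) (·-assoc-⊕0 c d gs)

  1· : ∀ {N} (g : Pt N) → 1# · g ≡ g
  1· []       = refl
  1· (g ∷ gs) = cong₂ _∷_ (R.*-identityˡ g) (1· gs)

  ·0⊕0 : ∀ a N → a · zeroV N ⊕ zeroV N ≡ zeroV N
  ·0⊕0 a zero    = refl
  ·0⊕0 a (suc N) = cong₂ _∷_ (trans (R.+-identityʳ (a *ᶠ 0#)) (R.zeroʳ a)) (·0⊕0 a N)

  allVecs-unique : ∀ N → Unique (allVecs N)
  allVecs-unique zero    = [] ∷ []
  allVecs-unique (suc N) = subst Unique (sym (concatMap-map _∷_ (allFin q) (allVecs N)))
    (Unique.cartesianProductWith⁺ _∷_ (λ { refl → refl , refl }) (Unique.allFin⁺ q) (allVecs-unique N))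

  ∈-allVecs : ∀ {N} (v : Pt N) → v ∈ allVecs N
  ∈-allVecs []                = here refl
  ∈-allVecs {suc N} (a ∷ v) = subst ((a ∷ v) ∈_) (sym (concatMap-map _∷_ (allFin q) (allVecs N)))
    (∈-cartesianProductWith⁺ _∷_ (∈-allFin a) (∈-allVecs v))

  -- Subsets of the space are Boolean predicates

  Sub : ℕ → Set
  Sub N = Pt N → Bool

  infix 4 _⊑_ _≐_
  infixl 7 _∩_

  _⊑_ _≐_ : ∀ {N} → Sub N → Sub N → Set
  A ⊑ B = ∀ {x} → A x ≡ true → B x ≡ true
  A ≐ B = ∀ x → A x ≡ B x

  _∩_ : ∀ {N} → Sub N → Sub N → Sub N
  (A ∩ B) x = A x ∧ B x

  size : ∀ {N} → Sub N → ℕ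
  size {N} A = ∑ (allVecs N) (λ x → ⟦ A x ⟧)

  size-cong : ∀ {N} {A B : Sub N} → A ≐ B → size A ≡ size B
  size-cong {N} h = ∑-cong (allVecs N) (λ x → cong ⟦_⟧ (h x))

  ⟦⟧-mono : ∀ {a b} → (a ≡ true → b ≡ true) → ⟦ a ⟧ ≤ ⟦ b ⟧
  ⟦⟧-mono {false} h = z≤n
  ⟦⟧-mono {true}  h rewrite h refl = ≤-refl

  size-mono : ∀ {N} {A B : Sub N} → A ⊑ B → size A ≤ size B
  size-mono {N} h = ∑-mono (allVecs N) (λ x → ⟦⟧-mono h)

  ⊑-size-≐ : ∀ {N} {A B : Sub N} → A ⊑ B → size A ≡ size B → A ≐ B
  ⊑-size-≐ {N} {A} {B} h e x = inj (∑-mono-≡ (allVecs N) (λ y → ⟦⟧-mono h) e (∈-allVecs x))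
    where
    inj : ∀ {a b} → ⟦ a ⟧ ≡ ⟦ b ⟧ → a ≡ b
    inj {true}  {true}  _ = refl
    inj {false} {false} _ = refl

  size-∖ : ∀ {N} (A B : Sub N) → size (λ x → A x ∧ not (B x)) ≡ size A ∸ size (A ∩ B)
  size-∖ {N} A B = sym (trans (cong (_∸ size (A ∩ B))
      (trans (∑-cong (allVecs N) (λ x → split (A x) (B x)))
             (∑-distrib-+ (allVecs N) (λ x → ⟦ A x ∧ not (B x) ⟧) (λ x → ⟦ A x ∧ B x ⟧))))
    (m+n∸n≡m (size (λ x → A x ∧ not (B x))) (size (A ∩ B))))
    where
    split : ∀ a b → ⟦ a ⟧ ≡ ⟦ a ∧ not b ⟧ + ⟦ a ∧ b ⟧
    split true  true  = refl
    split true  false = refl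
    split false b     = refl

  full : ∀ {N} → Sub N
  full _ = true

  size-full : ∀ N → size {N} full ≡ q ^ N
  size-full zero    = refl
  size-full (suc N) = trans (∑-concatMap (λ a → map (a ∷_) (allVecs N)) (allFin q) (λ _ → 1))
    (trans (∑-cong (allFin q) (λ a → trans (∑-map (a ∷_) (allVecs N) (λ _ → 1)) (size-full N)))
    (trans (∑-const (allFin q) (q ^ N)) (cong (_* q ^ N) (length-tabulate {n = q} id))))

  -- A single operation `c · u ⊕ v`, together with zero, covers addition and scaling; subtraction
  -- comes from negative scalars.
  record Closed {N} (A : Sub N) : Set where
    field
      zero∈ : A (zeroV N) ≡ true
      lin   : ∀ c {u v} → A u ≡ true → A v ≡ true → A (c · u ⊕ v) ≡ true

    scale : ∀ c {u} → A (c · u) ≡ true → c ≢ 0# → A u ≡ true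
    scale c {u} h c≢0 with inverse c c≢0
    ... | d , cd≡1 = subst (λ v → A v ≡ true)
      (trans (·-assoc-⊕0 d c u) (trans (cong (_· u) cd≡1) (1· u))) (lin d h zero∈)

    shift : ∀ c {u v} → A u ≡ true → A v ≡ true → A (v ⊕ c · u) ≡ true
    shift c {u} {v} hu hv = subst (λ w → A w ≡ true) (⊕-comm (c · u) v) (lin c hu hv)

    unshift : ∀ c {u v} → A u ≡ true → A (v ⊕ c · u) ≡ true → A v ≡ true
    unshift c {u} {v} hu h = subst (λ w → A w ≡ true) (⊕-cancel c v u) (shift (-ᶠ c) hu h)

  open Closed

  Closed-cong : ∀ {N} {A B : Sub N} → A ≐ B → Closed A → Closed B
  Closed-cong h cA = record
    { zero∈ = trans (sym (h _)) (zero∈ cA)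
    ; lin   = λ c hu hv → trans (sym (h _)) (lin cA c (trans (h _) hu) (trans (h _) hv)) }

  full-closed : ∀ {N} → Closed {N} full
  full-closed = record { zero∈ = refl ; lin = λ _ _ _ → refl }

  ∩-closed : ∀ {N} {A B : Sub N} → Closed A → Closed B → Closed (A ∩ B)
  ∩-closed cA cB = record
    { zero∈ = ∧-intro (zero∈ cA) (zero∈ cB)
    ; lin   = λ c hu hv → ∧-intro (lin cA c (proj₁ (∧-elim hu)) (proj₁ (∧-elim hv)))
                                  (lin cB c (proj₂ (∧-elim hu)) (proj₂ (∧-elim hv))) }

  origin : ∀ {N} → Sub N
  origin {N} v = does (zeroV N ≟V v)

  origin-zero : ∀ N → origin (zeroV N) ≡ true
  origin-zero N = dec-true (zeroV N ≟V zeroV N) refl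

  origin-sound : ∀ {N} {v : Pt N} → origin v ≡ true → zeroV N ≡ v
  origin-sound {N} {v} = does-sound (zeroV N ≟V v)

  origin-closed : ∀ {N} → Closed {N} origin
  origin-closed {N} = record { zero∈ = origin-zero N ; lin = λ c hu hv → go c (origin-sound hu) (origin-sound hv) }
    where
    go : ∀ c {u v} → zeroV N ≡ u → zeroV N ≡ v → origin (c · u ⊕ v) ≡ true
    go c refl refl = subst (λ w → origin w ≡ true) (sym (·0⊕0 c N)) (origin-zero N)

  origin-⊑ : ∀ {N} {A : Sub N} → Closed A → origin ⊑ A
  origin-⊑ {A = A} cA h = subst (λ v → A v ≡ true) (origin-sound h) (zero∈ cA)

  size-origin : ∀ N → size {N} origin ≡ 1
  size-origin N = count-unique (allVecs-unique N) origin (∈-allVecs (zeroV N)) (origin-zero N)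
    (λ _ h → sym (origin-sound h))

  -- Spans over a base subspace

  -- The sum of `B` and the line through `g`, with the multiple of `g` moved to the side of `x`: the
  -- search then runs over scalars only and not over members of `B`.
  ext : ∀ {N} → Sub N → Pt N → Sub N
  ext B g x = any (λ c → B (x ⊕ c · g)) (allFin q)

  ext-intro : ∀ {N} (B : Sub N) g c {x} → B (x ⊕ c · g) ≡ true → ext B g x ≡ true
  ext-intro B g c {x} = any-intro (λ d → B (x ⊕ d · g)) (∈-allFin c)

  ext-elim : ∀ {N} (B : Sub N) g {x} → ext B g x ≡ true → ∃ λ c → B (x ⊕ c · g) ≡ true
  ext-elim B g {x} h with any-elim (λ c → B (x ⊕ c · g)) (allFin q) h
  ... | c , _ , hc = c , hc

  ext-mono : ∀ {N} {A B : Sub N} g → A ⊑ B → ext A g ⊑ ext B g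
  ext-mono {A = A} {B} g A⊑B h with ext-elim A g h
  ... | c , hc = ext-intro B g c (A⊑B hc)

  ext-cong : ∀ {N} {A B : Sub N} g → A ≐ B → ext A g ≐ ext B g
  ext-cong {A = A} {B} g h x = bool-ext
    (ext-mono {A = A} {B} g (λ {y} e → trans (sym (h y)) e)) (ext-mono {A = B} {A} g (λ {y} e → trans (h y) e))

  ext-⊒ : ∀ {N} (B : Sub N) g → B ⊑ ext B g
  ext-⊒ B g {x} h = ext-intro B g 0# (subst (λ v → B v ≡ true) (sym (⊕-0· x g)) h)

  ext-∋ : ∀ {N} {B : Sub N} g → Closed B → ext B g g ≡ true
  ext-∋ {B = B} g cB = ext-intro B g (-ᶠ 1#) (subst (λ v → B v ≡ true) (sym (⊕-neg g)) (zero∈ cB))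

  ext-closed : ∀ {N} {B : Sub N} g → Closed B → Closed (ext B g)
  ext-closed {B = B} g cB = record { zero∈ = ext-⊒ B g (zero∈ cB) ; lin = lin′ }
    where
    lin′ : ∀ a {u v} → ext B g u ≡ true → ext B g v ≡ true → ext B g (a · u ⊕ v) ≡ true
    lin′ a {u} {v} hu hv with ext-elim B g hu | ext-elim B g hv
    ... | c , hc | d , hd = ext-intro B g (a *ᶠ c +ᶠ d)
      (subst (λ w → B w ≡ true) (⊕-combine a c d u v g) (lin cB a hc hd))

  size-translate : ∀ {N} (B : Sub N) c g → size (λ x → B (x ⊕ c · g)) ≡ size B
  size-translate {N} B c g = ∑-bijection (allVecs-unique N) ∈-allVecs
    (λ x → x ⊕ c · g) (λ x → x ⊕ (-ᶠ c) · g) (λ x → ⊕-cancel c x g) (λ x → ⊕-cancel′ c x g)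
    _≟V_ (λ x → ⟦ B x ⟧)

  -- When g ∉ B, the extension is the disjoint union of the translates B − c g.
  size-ext : ∀ {N} {B : Sub N} g → Closed B → ¬ (B g ≡ true) → size (ext B g) ≡ q * size B
  size-ext {N} {B} g cB g∉B = begin
    size (ext B g)
      ≡⟨ ∑-cong (allVecs N) disjoint ⟩
    ∑ (allVecs N) (λ x → ∑ (allFin q) (λ c → ⟦ B (x ⊕ c · g) ⟧))
      ≡⟨ ∑-swap (allVecs N) (allFin q) (λ x c → ⟦ B (x ⊕ c · g) ⟧) ⟩
    ∑ (allFin q) (λ c → size (λ x → B (x ⊕ c · g)))
      ≡⟨ ∑-cong (allFin q) (λ c → size-translate B c g) ⟩
    ∑ (allFin q) (λ _ → size B)
      ≡⟨ ∑-const (allFin q) (size B) ⟩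
    length (allFin q) * size B
      ≡⟨ cong (_* size B) (length-tabulate {n = q} id) ⟩
    q * size B ∎
    where
    open ≡-Reasoning
    unique : ∀ {x c d} → B (x ⊕ c · g) ≡ true → B (x ⊕ d · g) ≡ true → c ≡ d
    unique {x} {c} {d} hc hd with (d +ᶠ (-ᶠ 1#) *ᶠ c) ≟F 0#
    ... | yes e = f₇ d c e
    ... | no ne = ⊥-elim (g∉B (scale cB (d +ᶠ (-ᶠ 1#) *ᶠ c)
      (subst (λ v → B v ≡ true) (⊕-difference c d x g) (lin cB (-ᶠ 1#) hc hd)) ne))
    disjoint : ∀ x → ⟦ ext B g x ⟧ ≡ ∑ (allFin q) (λ c → ⟦ B (x ⊕ c · g) ⟧)
    disjoint x with ext B g x in e
    ... | true  = let c , hc = ext-elim B g e in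
      sym (count-unique (Unique.allFin⁺ q) (λ d → B (x ⊕ d · g)) (∈-allFin c) hc (λ _ hd → unique {x} hd hc))
    ... | false = sym (trans
      (∑-cong (allFin q) (λ c → cong ⟦_⟧ (¬true⇒false (λ hc → true≢false (trans (sym (ext-intro B g c hc)) e)))))
      (∑-zero (allFin q)))

  -- The base is a parameter because both spans over `origin` and spans over the fixed subspace `V`
  -- are needed.
  spanOver : ∀ {N} → Sub N → List (Pt N) → Sub N
  spanOver B []       = B
  spanOver B (g ∷ gs) = ext (spanOver B gs) g

  -- Independence modulo `B`, phrased without coefficients: each vector avoids the span of `B` and
  -- the vectors after it, so each one multiplies the size of the span by `q`.
  indep : ∀ {N} → Sub N → List (Pt N) → Bool
  indep B []       = true
  indep B (g ∷ gs) = indep B gs ∧ not (spanOver B gs g)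

  spanOver-closed : ∀ {N} {B : Sub N} gs → Closed B → Closed (spanOver B gs)
  spanOver-closed []       cB = cB
  spanOver-closed (g ∷ gs) cB = ext-closed g (spanOver-closed gs cB)

  spanOver-mono : ∀ {N} {A B : Sub N} gs → A ⊑ B → spanOver A gs ⊑ spanOver B gs
  spanOver-mono []       h = h
  spanOver-mono {A = A} {B} (g ∷ gs) h = ext-mono {A = spanOver A gs} {spanOver B gs} g (spanOver-mono gs h)

  spanOver-⊒ : ∀ {N} {B : Sub N} gs → B ⊑ spanOver B gs
  spanOver-⊒ []       h = h
  spanOver-⊒ {B = B} (g ∷ gs) h = ext-⊒ (spanOver B gs) g (spanOver-⊒ gs h)

  spanOver-∋ : ∀ {N} {B : Sub N} {gs} → Closed B → ∀ {g} → g ∈ gs → spanOver B gs g ≡ true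
  spanOver-∋ {gs = g ∷ gs} cB (here refl) = ext-∋ g (spanOver-closed gs cB)
  spanOver-∋ {B = B} {gs = g ∷ gs} cB (there m) = ext-⊒ (spanOver B gs) g (spanOver-∋ cB m)

  spanOver-least : ∀ {N} {B U : Sub N} gs → Closed U → B ⊑ U → all U gs ≡ true → spanOver B gs ⊑ U
  spanOver-least []       cU B⊑U _ h = B⊑U h
  spanOver-least {B = B} (g ∷ gs) cU B⊑U hgs h with ext-elim (spanOver B gs) g h
  ... | c , hc = unshift cU c (proj₁ (∧-elim hgs)) (spanOver-least gs cU B⊑U (proj₂ (∧-elim hgs)) hc)

  indep-anti : ∀ {N} {A B : Sub N} gs → A ⊑ B → indep B gs ≡ true → indep A gs ≡ true
  indep-anti []       h _ = refl
  indep-anti (g ∷ gs) h i = ∧-intro (indep-anti gs h (proj₁ (∧-elim i)))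
    (not-intro (λ e → not-elim (proj₂ (∧-elim i)) (spanOver-mono gs h e)))

  size-spanOver : ∀ {N} {B : Sub N} gs → Closed B → indep B gs ≡ true →
    size (spanOver B gs) ≡ q ^ length gs * size B
  size-spanOver {B = B} []       cB _ = sym (+-identityʳ (size B))
  size-spanOver {B = B} (g ∷ gs) cB i = trans
    (size-ext g (spanOver-closed gs cB) (not-elim (proj₂ (∧-elim i))))
    (trans (cong (q *_) (size-spanOver gs cB (proj₁ (∧-elim i)))) (sym (*-assoc q (q ^ length gs) (size B))))

  -- Dedekind's law. When `g` lies in `A`, the vectors `x` and `x ⊕ c · g` lie in `A` together, so
  -- membership in `A` passes through each extension.
  modular-law : ∀ {N} {A B : Sub N} gs → Closed A → all A gs ≡ true →
    A ∩ spanOver B gs ≐ spanOver (A ∩ B) gs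
  modular-law []       cA _   x = refl
  modular-law {A = A} {B} (g ∷ gs) cA hgs x = bool-ext to from
    where
    g∈A = proj₁ (∧-elim hgs)
    IH = modular-law {A = A} {B} gs cA (proj₂ (∧-elim hgs))
    to : A x ∧ ext (spanOver B gs) g x ≡ true → ext (spanOver (A ∩ B) gs) g x ≡ true
    to h with ∧-elim h
    ... | hA , hx with ext-elim (spanOver B gs) g hx
    ...   | c , hc = ext-intro (spanOver (A ∩ B) gs) g c
              (trans (sym (IH (x ⊕ c · g))) (∧-intro (shift cA c g∈A hA) hc))
    from : ext (spanOver (A ∩ B) gs) g x ≡ true → A x ∧ ext (spanOver B gs) g x ≡ true
    from h with ext-elim (spanOver (A ∩ B) gs) g h
    ... | c , hc with ∧-elim (trans (IH (x ⊕ c · g)) hc)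
    ...   | hA , hB = ∧-intro (unshift cA c g∈A hA) (ext-intro (spanOver B gs) g c hB)

  -- A tuple is extended by a vector of `A` outside `spanOver B gs`. The number of forbidden vectors
  -- depends only on the length of `gs`, hence the product.
  tuple-count : ∀ {N} {A B : Sub N} → Closed A → Closed B → ∀ m →
    ∑ (listsOf m (allVecs N)) (λ gs → ⟦ all A gs ∧ indep B gs ⟧) ≡ ∏ m (λ j → size A ∸ q ^ j * size (A ∩ B))
  tuple-count {N} {A} {B} cA cB zero    = refl
  tuple-count {N} {A} {B} cA cB (suc m) = begin
    ∑ (listsOf (suc m) Vs) (λ gs → ⟦ all A gs ∧ indep B gs ⟧)
      ≡⟨ ∑-listsOf m Vs _ ⟩
    ∑ Vs (λ g → ∑ (listsOf m Vs) (λ gs → ⟦ (A g ∧ all A gs) ∧ (indep B gs ∧ not (spanOver B gs g)) ⟧))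
      ≡⟨ ∑-swap Vs (listsOf m Vs) _ ⟩
    ∑ (listsOf m Vs) (λ gs → ∑ Vs (λ g → ⟦ (A g ∧ all A gs) ∧ (indep B gs ∧ not (spanOver B gs g)) ⟧))
      ≡⟨ ∑-cong∈ (listsOf m Vs) (λ {gs} m∈ → step gs (∈-listsOf⁻ m Vs m∈)) ⟩
    ∑ (listsOf m Vs) (λ gs → ⟦ all A gs ∧ indep B gs ⟧ * d)
      ≡⟨ ∑-*ʳ (listsOf m Vs) _ d ⟩
    ∑ (listsOf m Vs) (λ gs → ⟦ all A gs ∧ indep B gs ⟧) * d
      ≡⟨ cong (_* d) (tuple-count cA cB m) ⟩
    ∏ (suc m) (λ j → size A ∸ q ^ j * size (A ∩ B)) ∎
    where
    open ≡-Reasoning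
    Vs = allVecs N
    d = size A ∸ q ^ m * size (A ∩ B)
    rearrange : ∀ a b c e → ⟦ (a ∧ b) ∧ (c ∧ e) ⟧ ≡ ⟦ b ∧ c ⟧ * ⟦ a ∧ e ⟧
    rearrange true  true  true  e = sym (+-identityʳ ⟦ e ⟧)
    rearrange true  true  false e = refl
    rearrange true  false c     e = refl
    rearrange false b     c     e = sym (*-zeroʳ ⟦ b ∧ c ⟧)
    step : ∀ gs → length gs ≡ m →
      ∑ Vs (λ g → ⟦ (A g ∧ all A gs) ∧ (indep B gs ∧ not (spanOver B gs g)) ⟧) ≡ ⟦ all A gs ∧ indep B gs ⟧ * d
    step gs len = trans (∑-cong Vs (λ g → rearrange (A g) (all A gs) (indep B gs) (not (spanOver B gs g))))
      (trans (∑-*ˡ Vs ⟦ all A gs ∧ indep B gs ⟧ (λ g → ⟦ A g ∧ not (spanOver B gs g) ⟧)) final)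
      where
      final : ⟦ all A gs ∧ indep B gs ⟧ * size (λ g → A g ∧ not (spanOver B gs g)) ≡ ⟦ all A gs ∧ indep B gs ⟧ * d
      final with all A gs in ea | indep B gs in ei
      ... | false | _     = refl
      ... | true  | false = refl
      -- The forbidden vectors form `A ∩ spanOver B gs`, which is `spanOver (A ∩ B) gs` by the
      -- modular law; independence modulo `B` passes to the smaller base, so their number is
      -- `q ^ m * size (A ∩ B)`.
      ... | true  | true  = cong (_+ 0) (trans (size-∖ A (spanOver B gs)) (cong (size A ∸_)
        (trans (size-cong (modular-law gs cA ea))
        (trans (size-spanOver gs (∩-closed cA cB) (indep-anti {A = A ∩ B} gs (λ h → proj₂ (∧-elim h)) ei))
               (cong (λ l → q ^ l * size (A ∩ B)) len)))))

  span : ∀ {N} → List (Pt N) → Sub N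
  span = spanOver origin

  span-closed : ∀ {N} (gs : List (Pt N)) → Closed (span gs)
  span-closed gs = spanOver-closed gs origin-closed

  span-least : ∀ {N} {U : Sub N} gs → Closed U → all U gs ≡ true → span gs ⊑ U
  span-least gs cU = spanOver-least gs cU (origin-⊑ cU)

  -- Greedy thinning from the end of the list: a vector is kept only if it lies outside the span of
  -- those already kept.
  basis : ∀ {N} (vs : List (Pt N)) → ∃ λ gs → indep origin gs ≡ true × span gs ≐ span vs
  basis []       = [] , refl , λ _ → refl
  basis (v ∷ vs) with basis vs
  ... | gs , i , h with span gs v in e
  ...   | false = v ∷ gs , ∧-intro i (cong not e) , ext-cong v h
  ...   | true  = gs , i , λ x → bool-ext
      (λ hx → ext-⊒ (span vs) v (trans (sym (h x)) hx))
      (λ hx → let c , hc = ext-elim (span vs) v hx in unshift (span-closed gs) c e (trans (h _) hc))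

  closed-basis : ∀ {N} {A : Sub N} → Closed A → ∃ λ gs → indep origin gs ≡ true × span gs ≐ A
  closed-basis {N} {A} cA with basis (filterᵇ A (allVecs N))
  ... | gs , i , h = gs , i , λ x → trans (h x) (bool-ext
      (span-least vs cA (all-intro A vs (λ m → proj₂ (∈-filterᵇ⁻ A (allVecs N) m))))
      (λ hx → spanOver-∋ origin-closed (∈-filterᵇ⁺ A (∈-allVecs x) hx)))
    where vs = filterᵇ A (allVecs N)

  size-span : ∀ {N} (gs : List (Pt N)) → indep origin gs ≡ true → size (span gs) ≡ q ^ length gs
  size-span {N} gs i = trans (size-spanOver gs origin-closed i)
    (trans (cong (q ^ length gs *_) (size-origin N)) (*-identityʳ (q ^ length gs)))

  dimension : ∀ {N} {A : Sub N} → Closed A → ∃ λ r → size A ≡ q ^ r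
  dimension cA with closed-basis cA
  ... | gs , i , h = length gs , trans (sym (size-cong h)) (size-span gs i)

  -- The Boolean tests of the statement

  inSpan-intro : ∀ {N} cs (gs : List (Pt N)) → length cs ≡ length gs → inSpan gs (lincomb cs gs) ≡ true
  inSpan-intro cs gs e = any-intro (λ ds → does (lincomb ds gs ≟V lincomb cs gs))
    (subst (λ m → cs ∈ coeffs m) e (∈-listsOf⁺ ∈-allFin cs)) (dec-true (lincomb cs gs ≟V lincomb cs gs) refl)

  inSpan-elim : ∀ {N} (gs : List (Pt N)) {v} → inSpan gs v ≡ true →
    ∃ λ cs → length cs ≡ length gs × lincomb cs gs ≡ v
  inSpan-elim gs {v} h with any-elim (λ cs → does (lincomb cs gs ≟V v)) (coeffs (length gs)) h
  ... | cs , m , e = cs , ∈-listsOf⁻ (length gs) (allFin q) m , does-sound (_ ≟V _) e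

  lincomb∈span : ∀ {N} cs (gs : List (Pt N)) → length cs ≡ length gs → span gs (lincomb cs gs) ≡ true
  lincomb∈span {N} []    []       e = origin-zero N
  lincomb∈span (c ∷ cs) (g ∷ gs) e = lin (span-closed (g ∷ gs)) c (spanOver-∋ {gs = g ∷ gs} origin-closed (here refl))
    (ext-⊒ (span gs) g (lincomb∈span cs gs (suc-injective e)))

  span⇒lincomb : ∀ {N} (gs : List (Pt N)) {v} → span gs v ≡ true → ∃ λ cs → length cs ≡ length gs × lincomb cs gs ≡ v
  span⇒lincomb []       h = [] , refl , origin-sound h
  span⇒lincomb (g ∷ gs) {v} h with ext-elim (span gs) g h
  ... | c , hc with span⇒lincomb gs hc
  -- Membership in `ext` puts `v ⊕ c · g` in the smaller span, so the coefficient of `g` in `v` is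
  -- the negative of `c`.
  ...   | cs , len , e = (-ᶠ c) ∷ cs , cong suc len ,
      trans (cong ((-ᶠ c) · g ⊕_) e) (trans (⊕-comm ((-ᶠ c) · g) (v ⊕ c · g)) (⊕-cancel c v g))

  inSpan≐span : ∀ {N} (gs : List (Pt N)) → inSpan gs ≐ span gs
  inSpan≐span gs v = bool-ext
    (λ h → let cs , len , e = inSpan-elim gs h in subst (λ w → span gs w ≡ true) e (lincomb∈span cs gs len))
    (λ h → let cs , len , e = span⇒lincomb gs h in subst (λ w → inSpan gs w ≡ true) e (inSpan-intro cs gs len))

  Independent : ∀ {N} → List (Pt N) → Set
  Independent {N} gs = ∀ cs → length cs ≡ length gs → lincomb cs gs ≡ zeroV N → all (λ c → does (c ≟F 0#)) cs ≡ true

  independent-sound : ∀ {N} (gs : List (Pt N)) → independent gs ≡ true → Independent gs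
  independent-sound {N} gs h cs len e = go (all-elim _ h (subst (λ m → cs ∈ coeffs m) len (∈-listsOf⁺ ∈-allFin cs)))
    where
    go : not (does (lincomb cs gs ≟V zeroV N)) ∨ all (λ c → does (c ≟F 0#)) cs ≡ true → all (λ c → does (c ≟F 0#)) cs ≡ true
    go k rewrite dec-true (lincomb cs gs ≟V zeroV N) e = k

  independent-complete : ∀ {N} (gs : List (Pt N)) → Independent gs → independent gs ≡ true
  independent-complete {N} gs h = all-intro _ (coeffs (length gs)) (λ {cs} m → go cs (∈-listsOf⁻ (length gs) (allFin q) m))
    where
    go : ∀ cs → length cs ≡ length gs → not (does (lincomb cs gs ≟V zeroV N)) ∨ all (λ c → does (c ≟F 0#)) cs ≡ true
    go cs len with lincomb cs gs ≟V zeroV N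
    ... | yes e = h cs len e
    ... | no _  = refl

  -- If `g` were a combination of `gs`, prefixing its coefficients with minus one would give a
  -- relation, forcing minus one, and hence `1#`, to be zero.
  Independent⇒indep : ∀ {N} (gs : List (Pt N)) → Independent gs → indep origin gs ≡ true
  Independent⇒indep []       h = refl
  Independent⇒indep {N} (g ∷ gs) h = ∧-intro
    (Independent⇒indep gs (λ cs len e → proj₂ (∧-elim (h (0# ∷ cs) (cong suc len)
      (trans (⊕-comm (0# · g) (lincomb cs gs)) (trans (⊕-0· (lincomb cs gs) g) e))))))
    (not-intro λ g∈ → let cs , len , e = span⇒lincomb gs g∈ in
      0≢1 (sym (trans (sym (R.+-identityʳ 1#)) (trans (cong (1# +ᶠ_) (sym
        (does-sound (_ ≟F _) (proj₁ (∧-elim (h ((-ᶠ 1#) ∷ cs) (cong suc len)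
          (trans (cong ((-ᶠ 1#) · g ⊕_) e) (trans (⊕-comm ((-ᶠ 1#) · g) g) (⊕-neg g)))))))))
        (R.-‿inverseʳ 1#)))))

  -- A nonzero leading coefficient `c` would place `c · g`, and by scaling `g` itself, in the span
  -- of the other vectors.
  indep⇒Independent : ∀ {N} (gs : List (Pt N)) → indep origin gs ≡ true → Independent gs
  indep⇒Independent []       i [] len e = refl
  indep⇒Independent {N} (g ∷ gs) i (c ∷ cs) len e with c ≟F 0#
  ... | yes refl = indep⇒Independent gs (proj₁ (∧-elim i)) cs (suc-injective len)
      (trans (sym (trans (⊕-comm (0# · g) (lincomb cs gs)) (⊕-0· (lincomb cs gs) g))) e)
  ... | no c≢0 = ⊥-elim (not-elim (proj₂ (∧-elim i)) (scale (span-closed gs) c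
      (unshift′ (span-closed gs) (lincomb∈span cs gs (suc-injective len)) e) c≢0))
    where
    unshift′ : ∀ {A : Sub N} → Closed A → ∀ {u v} → A u ≡ true → v ⊕ u ≡ zeroV N → A v ≡ true
    unshift′ {A} cA {u} {v} hu e = unshift cA 1# hu (subst (λ w → A w ≡ true)
      (sym (trans (cong (v ⊕_) (1· u)) e)) (zero∈ cA))

  mem : ∀ {N} → List (Pt N) → Sub N
  mem S v = v ∈ᵇ S

  mem-intro : ∀ {N} {S : List (Pt N)} {v} → v ∈ S → mem S v ≡ true
  mem-intro {v = v} m = any-intro (λ w → does (v ≟V w)) m (dec-true (v ≟V v) refl)

  mem-elim : ∀ {N} {S : List (Pt N)} {v} → mem S v ≡ true → v ∈ S
  mem-elim {S = S} {v} h with any-elim (λ w → does (v ≟V w)) S h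
  ... | w , m , e with does-sound (v ≟V w) e
  ...   | refl = m

  mem-filterᵇ : ∀ {N} (A : Sub N) → mem (filterᵇ A (allVecs N)) ≐ A
  mem-filterᵇ {N} A x = bool-ext (λ h → proj₂ (∈-filterᵇ⁻ A (allVecs N) (mem-elim h)))
    (λ h → mem-intro (∈-filterᵇ⁺ A (∈-allVecs x) h))

  ⇔ᵇ-elim : ∀ {a b} → a ⇔ᵇ b ≡ true → a ≡ b
  ⇔ᵇ-elim {true}  {true}  _ = refl
  ⇔ᵇ-elim {false} {false} _ = refl

  ⇔ᵇ-intro : ∀ {a b} → a ≡ b → a ⇔ᵇ b ≡ true
  ⇔ᵇ-intro {true}  refl = refl
  ⇔ᵇ-intro {false} refl = refl

  subspace-sound : ∀ {N} k (S : List (Pt N)) → isSubspaceOfDim k S ≡ true → Closed (mem S) × size (mem S) ≡ q ^ k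
  subspace-sound {N} k S h
    with any-elim (λ gs → independent gs ∧ all (λ v → inSpan gs v ⇔ᵇ (v ∈ᵇ S)) (allVecs N)) (listsOf k (allVecs N)) h
  ... | gs , m , e = Closed-cong eq (span-closed gs) ,
    trans (sym (size-cong eq)) (trans (size-span gs (Independent⇒indep gs (independent-sound gs (proj₁ (∧-elim e)))))
      (cong (q ^_) (∈-listsOf⁻ k (allVecs N) m)))
    where
    eq : span gs ≐ mem S
    eq x = trans (sym (inSpan≐span gs x))
      (⇔ᵇ-elim (all-elim (λ v → inSpan gs v ⇔ᵇ (v ∈ᵇ S)) (proj₂ (∧-elim {independent gs} e)) (∈-allVecs x)))

  -- The basis sought by the test is the one from `closed-basis`; its length is `k` because distinct
  -- powers of `q` differ.
  subspace-complete : ∀ {N} k (S : List (Pt N)) → Closed (mem S) → size (mem S) ≡ q ^ k → isSubspaceOfDim k S ≡ true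
  subspace-complete {N} k S cS e with closed-basis cS
  ... | gs , i , h = any-intro (λ gs → independent gs ∧ all (λ v → inSpan gs v ⇔ᵇ (v ∈ᵇ S)) (allVecs N))
    (subst (λ l → gs ∈ listsOf l (allVecs N)) len (∈-listsOf⁺ ∈-allVecs gs))
    (∧-intro (independent-complete gs (indep⇒Independent gs i))
             (all-intro _ (allVecs N) (λ {v} _ → ⇔ᵇ-intro (trans (inSpan≐span gs v) (h v)))))
    where
    len : length gs ≡ k
    len = ^-injective (trans (sym (size-span gs i)) (trans (size-cong h) e))

  subspace-test : ∀ {N} k (S : List (Pt N)) → Closed (mem S) → isSubspaceOfDim k S ≡ does (size (mem S) ≟ q ^ k)
  subspace-test k S cS = bool-ext
    (λ h → dec-true (_ ≟ _) (proj₂ (subspace-sound k S h)))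
    (λ h → subspace-complete k S cS (does-sound (_ ≟ _) h))

-- Counting subspaces and points relative to a fixed subspace.

∑-product : (xs : List A) (ys : List B) (f : A → ℕ) (g : B → ℕ) →
  ∑ xs (λ x → ∑ ys (λ y → f x * g y)) ≡ ∑ xs f * ∑ ys g
∑-product xs ys f g = trans (∑-cong xs (λ x → ∑-*ˡ ys (f x) g)) (∑-*ʳ xs f (∑ ys g))

⟦⟧-*-cong : ∀ b {x y} → (b ≡ true → x ≡ y) → ⟦ b ⟧ * x ≡ ⟦ b ⟧ * y
⟦⟧-*-cong true  h = cong (_+ 0) (h refl)
⟦⟧-*-cong false h = refl

all-true : (xs : List A) → all (λ _ → true) xs ≡ true
all-true []       = refl
all-true (x ∷ xs) = all-true xs

module Counting {q : ℕ} (F : FiniteField q) where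
  open FiniteField F using (0#)
  open Over F
  open Linear F
  open Closed

  ∈-Grass⁻ : ∀ {N} k {U : List (Pt N)} → U ∈ Grass N k → Closed (mem U) × size (mem U) ≡ q ^ k
  ∈-Grass⁻ {N} k {U} m = subspace-sound k U (proj₂ (∈-filterᵇ⁻ (isSubspaceOfDim k) (sublists (allVecs N)) m))

  ∈-Grass⁺ : ∀ {N} k {A : Sub N} → Closed A → size A ≡ q ^ k → filterᵇ A (allVecs N) ∈ Grass N k
  ∈-Grass⁺ {N} k {A} cA e = ∈-filterᵇ⁺ (isSubspaceOfDim k) (filterᵇ-∈-sublists A (allVecs N))
    (subspace-complete k (filterᵇ A (allVecs N)) (Closed-cong (λ x → sym (mem-filterᵇ A x)) cA)
      (trans (size-cong (mem-filterᵇ A)) e))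

  Grass-unique : ∀ N k → Unique (Grass N k)
  Grass-unique N k = Unique.filter⁺ (T? ∘ isSubspaceOfDim k) (sublists-unique (allVecs-unique N))

  Grass-ext : ∀ {N} k {U : List (Pt N)} {A : Sub N} → U ∈ Grass N k → mem U ≐ A → U ≡ filterᵇ A (allVecs N)
  Grass-ext {N} k {U} {A} m h = sublists-ext (allVecs-unique N)
    (proj₁ (∈-filterᵇ⁻ (isSubspaceOfDim k) (sublists (allVecs N)) m)) (filterᵇ-∈-sublists A (allVecs N))
    (λ {x} x∈ → ∈-filterᵇ⁺ A (∈-allVecs x) (trans (sym (h x)) (mem-intro x∈)))
    (λ {x} x∈ → mem-elim (trans (h x) (proj₂ (∈-filterᵇ⁻ A (allVecs N) x∈))))

  ∩-origin : ∀ {N} {A : Sub N} → Closed A → size (A ∩ origin) ≡ 1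
  ∩-origin {N} {A} cA = trans (size-cong (λ x → bool-ext
    (λ h → proj₂ (∧-elim {A x} h)) (λ h → ∧-intro (origin-⊑ cA h) h))) (size-origin N)

  -- Vectors independent modulo `V` add nothing inside `V`: a nonzero coefficient of `u` would put
  -- `u` in the span of `V` and the remaining vectors.
  spanOver-∩ : ∀ {N} {B V : Sub N} us → Closed V → B ⊑ V → indep V us ≡ true →
    ∀ {x} → spanOver B us x ≡ true → V x ≡ true → B x ≡ true
  spanOver-∩ []       cV B⊑V i h v = h
  spanOver-∩ {N} {B} {V} (u ∷ us) cV B⊑V i {x} h v with ext-elim (spanOver B us) u h
  ... | c , hc with c ≟F 0#
  ...   | yes refl = spanOver-∩ us cV B⊑V (proj₁ (∧-elim i)) (subst (λ w → spanOver B us w ≡ true) (⊕-0· x u) hc) v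
  ...   | no c≢0   = ⊥-elim (not-elim (proj₂ (∧-elim {indep V us} i))
      (scale (spanOver-closed us cV) c (cancelˡ (spanOver-closed us cV) (spanOver-⊒ us v) (spanOver-mono us B⊑V hc)) c≢0))
    where
    cancelˡ : ∀ {A : Sub N} → Closed A → ∀ {u v} → A u ≡ true → A (u ⊕ v) ≡ true → A v ≡ true
    cancelˡ {A} cA {u} {v} hu h = unshift cA _ hu (subst (λ w → A w ≡ true)
      (trans (⊕-comm u v) (cong (v ⊕_) (sym (1· u)))) h)

  -- The subspaces U of dimension t + m with dim (U ∩ V) = t are counted through the pairs (as, us),
  -- where as is a basis of U ∩ V and us extends it to a basis of U: the t-tuple as is independent
  -- in V, the m-tuple us is independent modulo V, and U is their joint span.
  module Intersecting {N} {V : Sub N} (cV : Closed V) (s : ℕ) (sV : size V ≡ q ^ s) (t m : ℕ) where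

    private
      Vs = allVecs N

      α β : List (Pt N) → List (Pt N) → Bool
      α U as = (all V as ∧ indep origin as) ∧ all (mem U) as
      β U us = indep V us ∧ all (mem U) us

      hits : List (Pt N) → Bool
      hits U = does (size (mem U ∩ V) ≟ q ^ t)

      weight : List (Pt N) → List (Pt N) → List (Pt N) → ℕ
      weight U as us = ⟦ hits U ⟧ * (⟦ α U as ⟧ * ⟦ β U us ⟧)

    count : ℕ
    count = ∑ (Grass N (t + m)) (λ U → ⟦ hits U ⟧)

    private
      s≤N : s ≤ N
      s≤N = ^-cancel-≤ (subst₂ _≤_ sV (size-full N) (size-mono {A = V} {full} (λ _ → refl)))

      frames-in : ∀ {A : Sub N} a → Closed A → size A ≡ q ^ a → ∀ k →
        ∑ (listsOf k Vs) (λ as → ⟦ all A as ∧ indep origin as ⟧) ≡ frames a k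
      frames-in a cA e k = trans (tuple-count cA origin-closed k)
        (∏-cong k (λ j → cong₂ _∸_ e (trans (cong (q ^ j *_) (∩-origin cA)) (*-identityʳ (q ^ j)))))

      -- The image of `A` modulo `V` has dimension `a`, and each of its vectors lifts to `q ^ b`
      -- vectors of `A`.
      frames-mod : ∀ {A : Sub N} a b → Closed A → size A ≡ q ^ (b + a) → size (A ∩ V) ≡ q ^ b → ∀ k →
        ∑ (listsOf k Vs) (λ us → ⟦ all A us ∧ indep V us ⟧) ≡ q ^ (b * k) * frames a k
      frames-mod a b cA e e′ k = trans (tuple-count cA cV k)
        (trans (∏-cong k (λ j → cong₂ _∸_ e (trans (cong (q ^ j *_) e′)
           (trans (*-comm (q ^ j) (q ^ b)) (sym (^-distribˡ-+-* q b j))))))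
         (frames-shift b a k))

      -- For fixed `U` the two tuples are chosen independently: a basis of `U ∩ V`, and vectors of
      -- `U` forming a basis modulo `V`.
      by-subspace : ∀ {U} → U ∈ Grass N (t + m) →
        ∑ (listsOf t Vs) (λ as → ∑ (listsOf m Vs) (weight U as)) ≡ ⟦ hits U ⟧ * (frames t t * (q ^ (t * m) * frames m m))
      by-subspace {U} U∈ = trans
        (∑-cong (listsOf t Vs) (λ as → ∑-*ˡ (listsOf m Vs) ⟦ hits U ⟧ (λ us → ⟦ α U as ⟧ * ⟦ β U us ⟧)))
        (trans (∑-*ˡ (listsOf t Vs) ⟦ hits U ⟧ (λ as → ∑ (listsOf m Vs) (λ us → ⟦ α U as ⟧ * ⟦ β U us ⟧)))
        (trans (cong (⟦ hits U ⟧ *_) (∑-product (listsOf t Vs) (listsOf m Vs) (λ as → ⟦ α U as ⟧) (λ us → ⟦ β U us ⟧)))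
        final))
        where
        cU = proj₁ (∈-Grass⁻ (t + m) U∈)
        sU = proj₂ (∈-Grass⁻ (t + m) U∈)
        α-rearrange : ∀ as → α U as ≡ all (mem U ∩ V) as ∧ indep origin as
        α-rearrange as = trans (lem (all V as) (indep origin as) (all (mem U) as))
          (cong (_∧ indep origin as) (sym (all-∧ (mem U) V as)))
          where
          lem : ∀ a b c → (a ∧ b) ∧ c ≡ (c ∧ a) ∧ b
          lem true  true  true  = refl
          lem true  true  false = refl
          lem true  false true  = refl
          lem true  false false = refl
          lem false b     true  = refl
          lem false b     false = refl
        β-rearrange : ∀ us → β U us ≡ all (mem U) us ∧ indep V us
        β-rearrange us = bool-ext (λ h → let a , b = ∧-elim {indep V us} h in ∧-intro b a)
                                  (λ h → let a , b = ∧-elim {all (mem U) us} h in ∧-intro b a)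
        final : ⟦ hits U ⟧ * (∑ (listsOf t Vs) (λ as → ⟦ α U as ⟧) * ∑ (listsOf m Vs) (λ us → ⟦ β U us ⟧))
              ≡ ⟦ hits U ⟧ * (frames t t * (q ^ (t * m) * frames m m))
        -- The size of `U ∩ V` is known only when `hits U` holds, so both counts are made under that
        -- indicator.
        final = ⟦⟧-*-cong (hits U) (λ h → let e = does-sound (_ ≟ _) h in cong₂ _*_
          (trans (∑-cong (listsOf t Vs) (λ as → cong ⟦_⟧ (α-rearrange as))) (frames-in t (∩-closed cU cV) e t))
          (trans (∑-cong (listsOf m Vs) (λ us → cong ⟦_⟧ (β-rearrange us))) (frames-mod m t cU sU e m)))

      -- An admissible pair comes from exactly one `U`. Its joint span `E` has the right size and
      -- meets `V` in `span as`; any other candidate contains `E` and has the same size.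
      by-tuple : ∀ {as us} → as ∈ listsOf t Vs → us ∈ listsOf m Vs →
        ∑ (Grass N (t + m)) (λ U → weight U as us) ≡ ⟦ all V as ∧ indep origin as ⟧ * ⟦ indep V us ⟧
      by-tuple {as} {us} as∈ us∈ with all V as in ea | indep origin as in eo | indep V us in eu
      ... | false | _     | _     = trans (∑-cong (Grass N (t + m)) (λ U → *-zeroʳ ⟦ hits U ⟧)) (∑-zero (Grass N (t + m)))
      ... | true  | false | _     = trans (∑-cong (Grass N (t + m)) (λ U → *-zeroʳ ⟦ hits U ⟧)) (∑-zero (Grass N (t + m)))
      ... | true  | true  | false = trans (∑-cong (Grass N (t + m)) (λ U →
          trans (cong (⟦ hits U ⟧ *_) (*-zeroʳ ⟦ all (mem U) as ⟧)) (*-zeroʳ ⟦ hits U ⟧))) (∑-zero (Grass N (t + m)))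
      ... | true  | true  | true  = trans
          (∑-cong (Grass N (t + m)) (λ U → sym (trans (⟦∧⟧ (hits U) (all (mem U) as ∧ all (mem U) us))
            (cong (⟦ hits U ⟧ *_) (⟦∧⟧ (all (mem U) as) (all (mem U) us))))))
          (count-unique (Grass-unique N (t + m)) good (∈-Grass⁺ (t + m) cE sE) good-W unique)
        where
        good : List (Pt N) → Bool
        good U = hits U ∧ (all (mem U) as ∧ all (mem U) us)
        E : Sub N
        E = spanOver (span as) us
        cE : Closed E
        cE = spanOver-closed us (span-closed as)
        span⊑V : span as ⊑ V
        span⊑V = span-least as cV ea
        s-as : size (span as) ≡ q ^ t
        s-as = trans (size-span as eo) (cong (q ^_) (∈-listsOf⁻ t Vs as∈))
        sE : size E ≡ q ^ (t + m)
        sE = trans (size-spanOver us (span-closed as) (indep-anti us span⊑V eu))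
          (trans (cong₂ (λ l z → q ^ l * z) (∈-listsOf⁻ m Vs us∈) s-as)
          (trans (*-comm (q ^ m) (q ^ t)) (sym (^-distribˡ-+-* q t m))))
        W = filterᵇ E Vs
        W≐E : mem W ≐ E
        W≐E = mem-filterᵇ E
        W∩V : mem W ∩ V ≐ span as
        W∩V x = bool-ext
          (λ h → let w , v = ∧-elim {mem W x} h in spanOver-∩ us cV span⊑V eu (trans (sym (W≐E x)) w) v)
          (λ h → ∧-intro (trans (W≐E x) (spanOver-⊒ us h)) (span⊑V h))
        good-W : good W ≡ true
        good-W = ∧-intro (dec-true (_ ≟ _) (trans (size-cong W∩V) s-as))
          (∧-intro (all-intro (mem W) as (λ {x} x∈ → trans (W≐E x) (spanOver-⊒ us (spanOver-∋ origin-closed x∈))))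
                   (all-intro (mem W) us (λ {x} x∈ → trans (W≐E x) (spanOver-∋ (span-closed as) x∈))))
        unique : ∀ {U} → U ∈ Grass N (t + m) → good U ≡ true → U ≡ W
        unique {U} U∈ g = Grass-ext (t + m) U∈ (λ x → sym (⊑-size-≐ E⊑U (trans sE (sym sU)) x))
          where
          cU = proj₁ (∈-Grass⁻ (t + m) U∈)
          sU = proj₂ (∈-Grass⁻ (t + m) U∈)
          g′ = ∧-elim {all (mem U) as} (proj₂ (∧-elim {hits U} g))
          E⊑U : E ⊑ mem U
          E⊑U = spanOver-least us cU (span-least as cU (proj₁ g′)) (proj₂ g′)

      double-count : count * (frames t t * (q ^ (t * m) * frames m m)) ≡ frames s t * (q ^ (s * m) * frames (N ∸ s) m)
      double-count = begin
        count * (frames t t * (q ^ (t * m) * frames m m))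
          ≡⟨ sym (∑-*ʳ Gs (λ U → ⟦ hits U ⟧) _) ⟩
        ∑ Gs (λ U → ⟦ hits U ⟧ * (frames t t * (q ^ (t * m) * frames m m)))
          ≡⟨ sym (∑-cong∈ Gs by-subspace) ⟩
        ∑ Gs (λ U → ∑ Ts (λ as → ∑ Ms (weight U as)))
          ≡⟨ ∑-swap Gs Ts _ ⟩
        ∑ Ts (λ as → ∑ Gs (λ U → ∑ Ms (weight U as)))
          ≡⟨ ∑-cong Ts (λ as → ∑-swap Gs Ms (λ U us → weight U as us)) ⟩
        ∑ Ts (λ as → ∑ Ms (λ us → ∑ Gs (λ U → weight U as us)))
          ≡⟨ ∑-cong∈ Ts (λ as∈ → ∑-cong∈ Ms (λ us∈ → by-tuple as∈ us∈)) ⟩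
        ∑ Ts (λ as → ∑ Ms (λ us → ⟦ all V as ∧ indep origin as ⟧ * ⟦ indep V us ⟧))
          ≡⟨ ∑-product Ts Ms (λ as → ⟦ all V as ∧ indep origin as ⟧) (λ us → ⟦ indep V us ⟧) ⟩
        ∑ Ts (λ as → ⟦ all V as ∧ indep origin as ⟧) * ∑ Ms (λ us → ⟦ indep V us ⟧)
          ≡⟨ cong₂ _*_ (frames-in s cV sV t)
               -- The vacuous condition `all full us` makes this an instance of `frames-mod` for the
               -- whole space, with `b = s` and `a = N ∸ s`.
               (trans (∑-cong Ms (λ us → cong (λ b → ⟦ b ∧ indep V us ⟧) (sym (all-true us))))
                      (frames-mod (N ∸ s) s full-closed
                        (trans (size-full N) (cong (q ^_) (sym (m+[n∸m]≡n s≤N)))) sV m)) ⟩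
        frames s t * (q ^ (s * m) * frames (N ∸ s) m) ∎
        where
        open ≡-Reasoning
        Gs = Grass N (t + m)
        Ts = listsOf t Vs
        Ms = listsOf m Vs

    -- Lifting modulo `V` gives `q ^ (s * m)`, lifting modulo `U ∩ V` gives `q ^ (t * m)`; their
    -- quotient is the power of `q` in the formula.
    count-intersecting : t ≤ s → count ≡ G s t * G (N ∸ s) m * q ^ ((s ∸ t) * m)
    count-intersecting t≤s = frames-cancel t (^-cancel (t * m) (frames-cancel m (begin
      count * frames t t * q ^ (t * m) * frames m m
        ≡⟨ lem₁ count (frames t t) (q ^ (t * m)) (frames m m) ⟩
      count * (frames t t * (q ^ (t * m) * frames m m))
        ≡⟨ double-count ⟩
      frames s t * (q ^ (s * m) * frames (N ∸ s) m)
        ≡⟨ cong₂ (λ x y → x * (q ^ (s * m) * y)) (sym (G-frames s t)) (sym (G-frames (N ∸ s) m)) ⟩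
      G s t * frames t t * (q ^ (s * m) * (G (N ∸ s) m * frames m m))
        ≡⟨ cong (λ e → G s t * frames t t * (e * (G (N ∸ s) m * frames m m))) power ⟩
      G s t * frames t t * (q ^ ((s ∸ t) * m) * q ^ (t * m) * (G (N ∸ s) m * frames m m))
        ≡⟨ lem₂ (G s t) (frames t t) (q ^ ((s ∸ t) * m)) (q ^ (t * m)) (G (N ∸ s) m) (frames m m) ⟩
      G s t * G (N ∸ s) m * q ^ ((s ∸ t) * m) * frames t t * q ^ (t * m) * frames m m ∎)))
      where
      open ≡-Reasoning
      lem₁ : ∀ a b c d → a * b * c * d ≡ a * (b * (c * d))
      lem₁ = solve-∀
      lem₂ : ∀ a b c d e f → a * b * (c * d * (e * f)) ≡ a * e * c * b * d * f
      lem₂ = solve-∀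
      power : q ^ (s * m) ≡ q ^ ((s ∸ t) * m) * q ^ (t * m)
      power = trans (cong (λ z → q ^ (z * m)) (sym (m∸n+n≡m t≤s)))
        (trans (cong (q ^_) (*-distribʳ-+ m (s ∸ t) t)) (^-distribˡ-+-* q ((s ∸ t) * m) (t * m)))

  open Intersecting using (count-intersecting)

  -- The counterpart of the convention that `gauss` vanishes at a negative lower index: `U ∩ V`
  -- cannot be larger than `U`.
  count-intersecting-0 : ∀ {N} (V : Sub N) i t → i < t →
    ∑ (Grass N i) (λ U → ⟦ does (size (mem U ∩ V) ≟ q ^ t) ⟧) ≡ 0
  count-intersecting-0 {N} V i t i<t = trans (∑-cong∈ (Grass N i) (λ {U} U∈ → cong ⟦_⟧
    (dec-false (size (mem U ∩ V) ≟ q ^ t) (λ e → <⇒≱ (^-monoʳ-< q 1<q i<t)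
      (subst₂ _≤_ e (proj₂ (∈-Grass⁻ i U∈)) (size-mono {A = mem U ∩ V} {mem U} (λ {x} h → proj₁ (∧-elim {mem U x} h))))))))
    (∑-zero (Grass N i))

  -- Taking the origin for `V` with `s = t = 0` makes the intersection count equal to `G N k`, which
  -- is positive; a sum over an empty `Grass N k` would be zero.
  Grass-nonEmpty : ∀ N k → k ≤ N → length (Grass N k) ≢ 0
  Grass-nonEmpty N k k≤N e = >⇒≢ (G-pos k≤N) (trans (sym (trans (count-intersecting origin-closed 0 (size-origin N) 0 k z≤n)
      (trans (*-identityʳ (G N k + 0)) (+-identityʳ (G N k))))) (zero-sum (Grass N k) e))
    where
    G-pos : ∀ {n k} → k ≤ n → 0 < G n k
    G-pos z≤n = z<s
    G-pos {suc n} {suc k} (s≤s k≤n) = ≤-trans (G-pos k≤n) (m≤m+n (G n k) _)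
    zero-sum : ∀ {A : Set} (xs : List A) {f : A → ℕ} → length xs ≡ 0 → ∑ xs f ≡ 0
    zero-sum [] _ = refl

  line-unique : ∀ {N} {L : List (Pt N)} {v} → L ∈ Grass N 1 → mem L v ≡ true → ¬ (origin v ≡ true) →
    mem L ≐ span (v ∷ [])
  line-unique {N} {L} {v} L∈ hv v≢0 x = sym (⊑-size-≐ {A = span (v ∷ [])}
    (span-least (v ∷ []) (proj₁ (∈-Grass⁻ 1 L∈)) (∧-intro hv refl))
    (trans (size-span (v ∷ []) (not-intro v≢0)) (sym (proj₂ (∈-Grass⁻ 1 L∈)))) x)

  -- Incidences of lines with their nonzero vectors are counted twice: each line has `q ∸ 1` such
  -- vectors, and each vector of `U` outside `V` spans one line. A line lies in `V` as soon as one
  -- of its nonzero vectors does.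
  count-points : ∀ {N} {U V : Sub N} → Closed U → Closed V →
    ∑ (Grass N 1) (λ L → ⟦ all U L ∧ not (all V L) ⟧) * (q ∸ 1) ≡ size U ∸ size (U ∩ V)
  count-points {N} {U} {V} cU cV = begin
    ∑ Ls (λ L → ⟦ all U L ∧ not (all V L) ⟧) * (q ∸ 1)
      ≡⟨ sym (∑-*ʳ Ls _ (q ∸ 1)) ⟩
    ∑ Ls (λ L → ⟦ all U L ∧ not (all V L) ⟧ * (q ∸ 1))
      ≡⟨ ∑-cong∈ Ls (λ {L} L∈ → cong (⟦ all U L ∧ not (all V L) ⟧ *_) (sym (punctured L∈))) ⟩
    ∑ Ls (λ L → ⟦ all U L ∧ not (all V L) ⟧ * size (λ v → mem L v ∧ not (origin v)))
      ≡⟨ sym (∑-cong Ls (λ L → trans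
           (∑-cong (allVecs N) (λ v → ⟦∧⟧ (all U L ∧ not (all V L)) (mem L v ∧ not (origin v))))
           (∑-*ˡ (allVecs N) ⟦ all U L ∧ not (all V L) ⟧ _))) ⟩
    ∑ Ls (λ L → ∑ (allVecs N) (λ v → ⟦ on L v ⟧))
      ≡⟨ ∑-swap Ls (allVecs N) _ ⟩
    ∑ (allVecs N) (λ v → ∑ Ls (λ L → ⟦ on L v ⟧))
      ≡⟨ ∑-cong (allVecs N) one-line ⟩
    size (λ v → U v ∧ not (V v))
      ≡⟨ size-∖ U V ⟩
    size U ∸ size (U ∩ V) ∎
    where
    open ≡-Reasoning
    Ls = Grass N 1
    on : List (Pt N) → Pt N → Bool
    on L v = (all U L ∧ not (all V L)) ∧ (mem L v ∧ not (origin v))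
    punctured : ∀ {L} → L ∈ Ls → size (λ v → mem L v ∧ not (origin v)) ≡ q ∸ 1
    punctured {L} L∈ = trans (size-∖ (mem L) origin)
      (cong₂ _∸_ (trans (proj₂ (∈-Grass⁻ 1 L∈)) (*-identityʳ q)) (∩-origin (proj₁ (∈-Grass⁻ 1 L∈))))
    all-line : ∀ {A : Sub N} {L v} → Closed A → L ∈ Ls → mem L v ≡ true → ¬ (origin v ≡ true) → A v ≡ true → all A L ≡ true
    all-line {A} {L} {v} cA L∈ hv v≢0 h = all-intro A L (λ {x} x∈ →
      span-least (v ∷ []) cA (∧-intro h refl) (trans (sym (line-unique L∈ hv v≢0 x)) (mem-intro x∈)))
    one-line : ∀ v → ∑ Ls (λ L → ⟦ on L v ⟧) ≡ ⟦ U v ∧ not (V v) ⟧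
    one-line v with U v ∧ not (V v) in e
    ... | false = trans (∑-cong∈ Ls (λ {L} L∈ → cong ⟦_⟧ (¬true⇒false (λ h →
        let uv , lv = ∧-elim {all U L ∧ not (all V L)} h
            u , v∉ = ∧-elim {all U L} uv
            l , v≢0 = ∧-elim {mem L v} lv
        in true≢false (trans (sym (∧-intro (all-elim U {L} u (mem-elim {S = L} l))
             (not-intro (λ Vv → not-elim v∉ (all-line cV L∈ l (not-elim v≢0) Vv))))) e)))))
        (∑-zero Ls)
    ... | true = count-unique (Grass-unique N 1) (λ L → on L v) M∈ on-M
        (λ {L} L∈ h → let l , v≢0 = ∧-elim {mem L v} (proj₂ (∧-elim {all U L ∧ not (all V L)} h)) in
          Grass-ext 1 L∈ (line-unique L∈ l (not-elim v≢0)))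
      where
      Uv = proj₁ (∧-elim {U v} e)
      V∌v = not-elim (proj₂ (∧-elim {U v} e))
      v≢0 : ¬ (origin v ≡ true)
      v≢0 h = V∌v (origin-⊑ cV h)
      M = filterᵇ (span (v ∷ [])) (allVecs N)
      M∈ : M ∈ Ls
      M∈ = ∈-Grass⁺ 1 (span-closed (v ∷ [])) (size-span (v ∷ []) (not-intro v≢0))
      M∋v : mem M v ≡ true
      M∋v = trans (mem-filterᵇ (span (v ∷ [])) v) (spanOver-∋ {gs = v ∷ []} origin-closed (here refl))
      on-M : on M v ≡ true
      on-M = ∧-intro
        (∧-intro (all-line cU M∈ M∋v v≢0 Uv) (not-intro (λ h → V∌v (all-elim V {M} h (mem-elim {S = M} M∋v)))))
        (∧-intro M∋v (not-intro v≢0))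

-- Evaluation of `lam` and of the average.

/ℕ-unique : ∀ {m n d} → d ≢ 0 → m * d ≡ n → n /ℕ d ≡ m
/ℕ-unique {m} {n} {d} d≢0 e with d ≟ 0
... | yes d≡0 = contradiction d≡0 d≢0
... | no d≢0′ = trans (cong (λ z → ℕ._/_ z d {{≢-nonZero d≢0′}}) (sym e)) (ℕ.m*n/n≡m m d {{≢-nonZero d≢0′}})

gauss-≥ : ∀ q a {i t} → t ≤ i → gauss q a (pos i ℤ.- pos t) ≡ gaussℕ q a (i ∸ t)
gauss-≥ q a {i} {t} t≤i = cong (gauss q a) (trans (ℤ.m-n≡m⊖n i t) (ℤ.⊖-≥ t≤i))

gauss-< : ∀ q a {i t} → i < t → gauss q a (pos i ℤ.- pos t) ≡ 0ℚ
gauss-< q a {i} {t} i<t = trans (cong (gauss q a) (trans (ℤ.m-n≡m⊖n i t) (ℤ.⊖-< i<t))) (neg (m<n⇒0<n∸m i<t))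
  where
  neg : ∀ {d} → 0 < d → gauss q a (ℤ.- pos d) ≡ 0ℚ
  neg {suc d} _ = refl

ι-∑-const : (xs : List A) (f : A → ℕ) {c : ℚ} → (∀ {x} → x ∈ xs → ℕ→ℚ (f x) ≡ c) →
  ℕ→ℚ (∑ xs f) ≡ c ℚ.* ℕ→ℚ (length xs)
ι-∑-const []       f {c} h = sym (ℚ.*-zeroʳ c)
ι-∑-const (x ∷ xs) f {c} h = trans (ι-+ (f x) (∑ xs f))
  (trans (cong₂ ℚ._+_ (trans (h (here refl)) (sym (ℚ.*-identityʳ c))) (ι-∑-const xs f (h ∘ there)))
  (trans (sym (ℚ.*-distribˡ-+ c 1ℚ (ℕ→ℚ (length xs)))) (cong (c ℚ.*_) (sym (ι-+ 1 (length xs))))))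

module Main {q : ℕ} (F : FiniteField q) where
  open Over F
  open Linear F
  open Counting F
  open Gaussℚ q 1<q

  q∸1≢0 : q ∸ 1 ≢ 0
  q∸1≢0 = >⇒≢ (m<n⇒0<n∸m 1<q)

  inside : ∀ {N} → List (Pt N) → List (List (Pt N)) → Bool
  inside U P = all (λ L → L ⊆ᵇ U) P

  all-concat : (p : A → Bool) (xss : List (List A)) → all (all p) xss ≡ all p (concat xss)
  all-concat p xss = bool-ext
    (λ h → all-intro p (concat xss) (λ m → let xs , x∈ , xs∈ = ∈-concat⁻′ xss m in all-elim p {xs} (all-elim (all p) {xss} h xs∈) x∈))
    (λ h → all-intro (all p) xss (λ {xs} xs∈ → all-intro p xs (λ x∈ → all-elim p {concat xss} h (∈-concat⁺′ x∈ xs∈))))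

  -- Containment is recast as an intersection of full size with the span of `P`, the form that
  -- `Intersecting` counts.
  inside-test : ∀ {N} r {U : List (Pt N)} (P : List (List (Pt N))) → Closed (mem U) → size (span (concat P)) ≡ q ^ r →
    inside U P ≡ does (size (mem U ∩ span (concat P)) ≟ q ^ r)
  inside-test {N} r {U} P cU e = trans (all-concat (mem U) P) (bool-ext to from)
    where
    S = span (concat P)
    to : all (mem U) (concat P) ≡ true → does (size (mem U ∩ S) ≟ q ^ r) ≡ true
    to h = dec-true (_ ≟ _) (trans (size-cong (λ x → bool-ext
      (λ k → proj₂ (∧-elim {mem U x} k)) (λ k → ∧-intro (span-least (concat P) cU h k) k))) e)
    from : does (size (mem U ∩ S) ≟ q ^ r) ≡ true → all (mem U) (concat P) ≡ true
    from h = all-intro (mem U) (concat P) (λ {x} x∈ → proj₁ (∧-elim {mem U x} (trans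
      (⊑-size-≐ {A = mem U ∩ S} {S} (λ {y} k → proj₂ (∧-elim {mem U y} k)) (trans (does-sound (_ ≟ _) h) (sym e)) x)
      (spanOver-∋ origin-closed x∈))))

  mem-⟨⟩ : ∀ {N} (P : List (List (Pt N))) → mem ⟨ P ⟩ ≐ span (concat P)
  mem-⟨⟩ P x = trans (mem-filterᵇ (inSpan (concat P)) x) (inSpan≐span (concat P) x)

  inversion-at : ∀ N ρ → ρ ≤ N → (P : List (List (Pt N))) →
    ∑< (suc ρ) (λ i → coefficient (ρ ∸ i) ℚ.* gaussℕ q (N ∸ i) (ρ ∸ i) ℚ.* ℕ→ℚ (∑ (Grass N i) (λ U → ⟦ inside U P ⟧)))
      ≡ ℕ→ℚ ⟦ isSubspaceOfDim ρ ⟨ P ⟩ ⟧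
  inversion-at N ρ ρ≤N P = trans (inversion N ρ r ρ≤N H H< H≥) (cong (λ b → ℕ→ℚ ⟦ b ⟧) (bool-ext
      (λ h → trans test (dec-true (_ ≟ _) (trans size⟨⟩ (cong (q ^_) (does-sound (r ≟ ρ) h)))))
      (λ h → dec-true (r ≟ ρ) (^-injective (trans (sym size⟨⟩) (does-sound (size (mem ⟨ P ⟩) ≟ q ^ ρ) (trans (sym test) h)))))))
    where
    S = span (concat P)
    r = proj₁ (dimension (span-closed (concat P)))
    e = proj₂ (dimension (span-closed (concat P)))
    H : ℕ → ℕ
    H i = ∑ (Grass N i) (λ U → ⟦ inside U P ⟧)
    H-intersecting : ∀ i → H i ≡ ∑ (Grass N i) (λ U → ⟦ does (size (mem U ∩ S) ≟ q ^ r) ⟧)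
    H-intersecting i = ∑-cong∈ (Grass N i) (λ {U} U∈ → cong ⟦_⟧ (inside-test r {U} P (proj₁ (∈-Grass⁻ i U∈)) e))
    H< : ∀ i → i < r → H i ≡ 0
    H< i i<r = trans (H-intersecting i) (count-intersecting-0 S i r i<r)
    H≥ : ∀ j → H (r + j) ≡ G (N ∸ r) j
    H≥ j = trans (H-intersecting (r + j)) (trans (Intersecting.count-intersecting (span-closed (concat P)) r e r j ≤-refl)
      -- With `s = t = r` the factor `G r r` and the power with exponent `(r ∸ r) * j` both become
      -- 1.
      (trans (cong₂ (λ x y → x * G (N ∸ r) j * q ^ (y * j)) (G-self r) (n∸n≡0 r))
      (trans (*-identityʳ _) (+-identityʳ (G (N ∸ r) j)))))
    size⟨⟩ : size (mem ⟨ P ⟩) ≡ q ^ r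
    size⟨⟩ = trans (size-cong (mem-⟨⟩ P)) e
    test : isSubspaceOfDim ρ ⟨ P ⟩ ≡ does (size (mem ⟨ P ⟩) ≟ q ^ ρ)
    test = subspace-test ρ ⟨ P ⟩ (Closed-cong (λ x → sym (mem-⟨⟩ P x)) (span-closed (concat P)))

  module Avoiding (N s ℓ : ℕ) (W : List (Pt N)) (cW : Closed (mem W)) (sW : size (mem W) ≡ q ^ s) where

    Ps = sublists (Grass N 1)

    avoids : List (List (Pt N)) → Bool
    avoids P = does (length P ≟ ℓ) ∧ distinguishes W P

    pairs : ℕ → ℕ
    pairs i = ∑ (Grass N i) (λ U → ∑ Ps (λ P → ⟦ avoids P ⟧ * ⟦ inside U P ⟧))

    choices : ℕ → ℕ → ℕ
    choices i t = ((q ^ i ∸ q ^ t) /ℕ (q ∸ 1)) C ℓ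

    meets : ℕ → List (Pt N) → Bool
    meets t U = does (size (mem U ∩ mem W) ≟ q ^ t)

    -- Only `t = dim (U ∩ W)` contributes to the sum. For it the division by `q ∸ 1` is exact by
    -- `count-points`, and the `ℓ`-subsets of the points of `U` outside `W` give the binomial.
    inner : ∀ {i U} → U ∈ Grass N i →
      ∑ Ps (λ P → ⟦ avoids P ⟧ * ⟦ inside U P ⟧) ≡ ∑ (upTo (suc s)) (λ t → ⟦ meets t U ⟧ * choices i t)
    inner {i} {U} U∈ = begin
      ∑ Ps (λ P → ⟦ avoids P ⟧ * ⟦ inside U P ⟧)
        ≡⟨ ∑-cong Ps (λ P → trans (sym (⟦∧⟧ (avoids P) (inside U P))) (cong ⟦_⟧ (regroup P))) ⟩
      ∑ Ps (λ P → ⟦ does (length P ≟ ℓ) ∧ all outer P ⟧)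
        ≡⟨ count-sublists outer (Grass N 1) ℓ ⟩
      ∑ (Grass N 1) (λ L → ⟦ outer L ⟧) C ℓ
        ≡⟨ cong (_C ℓ) (sym (/ℕ-unique {n = q ^ i ∸ q ^ t} q∸1≢0 (trans (count-points cU cW) (cong₂ _∸_ sU e)))) ⟩
      choices i t
        ≡⟨ sym (+-identityʳ (choices i t)) ⟩
      1 * choices i t
        ≡⟨ cong (λ b → ⟦ b ⟧ * choices i t) (sym (dec-true (size (mem U ∩ mem W) ≟ q ^ t) e)) ⟩
      ⟦ meets t U ⟧ * choices i t
        ≡⟨ sym (∑-unique (Unique.upTo⁺ (suc s)) (λ t′ → ⟦ meets t′ U ⟧ * choices i t′) (∈-upTo⁺ (s≤s t≤s))
             (λ {t′} _ t′≢t → cong (λ b → ⟦ b ⟧ * choices i t′)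
               (dec-false (size (mem U ∩ mem W) ≟ q ^ t′) (λ e′ → t′≢t (^-injective (trans (sym e′) e)))))) ⟩
      ∑ (upTo (suc s)) (λ t′ → ⟦ meets t′ U ⟧ * choices i t′) ∎
      where
      open ≡-Reasoning
      cU = proj₁ (∈-Grass⁻ i U∈)
      sU = proj₂ (∈-Grass⁻ i U∈)
      t = proj₁ (dimension (∩-closed cU cW))
      e = proj₂ (dimension (∩-closed cU cW))
      outer : List (Pt N) → Bool
      outer L = all (mem U) L ∧ not (all (mem W) L)
      regroup : ∀ P → avoids P ∧ inside U P ≡ does (length P ≟ ℓ) ∧ all outer P
      regroup P = trans (lem (does (length P ≟ ℓ)) (distinguishes W P) (inside U P))
        (cong (does (length P ≟ ℓ) ∧_) (sym (all-∧ (all (mem U)) (λ L → not (all (mem W) L)) P)))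
        where
        lem : ∀ a b c → (a ∧ b) ∧ c ≡ a ∧ (c ∧ b)
        lem false b     c     = refl
        lem true  true  true  = refl
        lem true  true  false = refl
        lem true  false true  = refl
        lem true  false false = refl
      t≤s : t ≤ s
      -- The intersection lies in `W`, so its dimension is within the range of summation.
      t≤s = ^-cancel-≤ (subst₂ _≤_ e sW (size-mono {A = mem U ∩ mem W} {mem W} (λ {x} h → proj₂ (∧-elim {mem U x} h))))

    pairs-by-subspaces : ∀ i → ℕ→ℚ (pairs i) ≡ sumTo s (λ t →
      ℕ→ℚ (choices i t) ℚ.* gaussℕ q s t ℚ.* gauss q (N ∸ s) (pos i ℤ.- pos t) ℚ.* ℕ→ℚ (q ^ ((s ∸ t) * (i ∸ t))))
    pairs-by-subspaces i = begin
      ℕ→ℚ (pairs i)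
        ≡⟨ cong ℕ→ℚ (trans (∑-cong∈ (Grass N i) (inner {i}))
             (trans (∑-swap (Grass N i) (upTo (suc s)) (λ U t → ⟦ meets t U ⟧ * choices i t))
                    (∑-cong (upTo (suc s)) (λ t → ∑-*ʳ (Grass N i) (λ U → ⟦ meets t U ⟧) (choices i t))))) ⟩
      ℕ→ℚ (∑ (upTo (suc s)) (λ t → ∑ (Grass N i) (λ U → ⟦ meets t U ⟧) * choices i t))
        ≡⟨ ι-∑ (upTo (suc s)) (λ t → ∑ (Grass N i) (λ U → ⟦ meets t U ⟧) * choices i t) ⟩
      ∑< (suc s) (λ t → ℕ→ℚ (∑ (Grass N i) (λ U → ⟦ meets t U ⟧) * choices i t))
        ≡⟨ ∑<-cong (suc s) (λ t t<1+s → term t (s≤s⁻¹ t<1+s)) ⟩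
      ∑< (suc s) (λ t →
        ℕ→ℚ (choices i t) ℚ.* gaussℕ q s t ℚ.* gauss q (N ∸ s) (pos i ℤ.- pos t) ℚ.* ℕ→ℚ (q ^ ((s ∸ t) * (i ∸ t)))) ∎
      where
      open ≡-Reasoning
      term : ∀ t → t ≤ s → ℕ→ℚ (∑ (Grass N i) (λ U → ⟦ meets t U ⟧) * choices i t) ≡
        ℕ→ℚ (choices i t) ℚ.* gaussℕ q s t ℚ.* gauss q (N ∸ s) (pos i ℤ.- pos t) ℚ.* ℕ→ℚ (q ^ ((s ∸ t) * (i ∸ t)))
      term t t≤s = go (t ≤? i)
        where
        a = G s t
        b = G (N ∸ s) (i ∸ t)
        c = choices i t
        d = q ^ ((s ∸ t) * (i ∸ t))
        x = ℕ→ℚ c ℚ.* gaussℕ q s t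
        go : Dec (t ≤ i) → ℕ→ℚ (∑ (Grass N i) (λ U → ⟦ meets t U ⟧) * c) ≡ x ℚ.* gauss q (N ∸ s) (pos i ℤ.- pos t) ℚ.* ℕ→ℚ d
        go (yes t≤i) = trans (cong (λ n → ℕ→ℚ (n * choices i t))
              (subst (λ i′ → ∑ (Grass N i′) (λ U → ⟦ meets t U ⟧) ≡ G s t * G (N ∸ s) (i ∸ t) * q ^ ((s ∸ t) * (i ∸ t)))
                (m+[n∸m]≡n t≤i) (Intersecting.count-intersecting cW s sW t (i ∸ t) t≤s)))
            (trans (ι-* (a * b * d) c)
            (trans (cong (ℚ._* ℕ→ℚ c) (trans (ι-* (a * b) d) (cong (ℚ._* ℕ→ℚ d) (ι-* a b))))
            (trans (ℚ-Solver.solve 4 (λ a b d c → a :* b :* d :* c := c :* a :* b :* d) refl (ℕ→ℚ a) (ℕ→ℚ b) (ℕ→ℚ d) (ℕ→ℚ c))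
            (sym (cong₂ (λ x y → ℕ→ℚ c ℚ.* x ℚ.* y ℚ.* ℕ→ℚ d) (gaussℕ≡G s t)
                   (trans (gauss-≥ q (N ∸ s) t≤i) (gaussℕ≡G (N ∸ s) (i ∸ t))))))))
        -- Both sides vanish: no `U` of dimension `i` can meet `W` in `q ^ t` vectors, and the lower
        -- index `i - t` of `gauss` is negative.
        go (no t≰i) = trans (cong (λ n → ℕ→ℚ (n * c)) (count-intersecting-0 (mem W) i t (≰⇒> t≰i)))
          (sym (trans (cong (λ z → x ℚ.* z ℚ.* ℕ→ℚ d) (gauss-< q (N ∸ s) (≰⇒> t≰i)))
            (trans (cong (ℚ._* ℕ→ℚ d) (ℚ.*-zeroʳ x)) (ℚ.*-zeroˡ (ℕ→ℚ d)))))

    -- With the pairs summed over `P` last, the alternating sum for each `P` is the one in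
    -- `inversion-at`, so it selects the `P` of rank `ρ`.
    lam-counts : ∀ ρ → ρ ≤ N → lam q N s ℓ ρ ≡ ℕ→ℚ (∑ Ps (λ P → ⟦ avoids P ⟧ * ⟦ isSubspaceOfDim ρ ⟨ P ⟩ ⟧))
    lam-counts ρ ρ≤N = begin
      lam q N s ℓ ρ
        ≡⟨ ∑<-cong (suc ρ) (λ i _ → cong (c i ℚ.*_) (sym (pairs-by-subspaces i))) ⟩
      ∑< (suc ρ) (λ i → c i ℚ.* ℕ→ℚ (pairs i))
        ≡⟨ ∑<-cong (suc ρ) (λ i _ → expand i) ⟩
      ∑< (suc ρ) (λ i → ∑ℚ Ps (λ P → ℕ→ℚ ⟦ avoids P ⟧ ℚ.* (c i ℚ.* ℕ→ℚ (H P i))))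
        ≡⟨ ∑<-∑ℚ-swap (suc ρ) Ps (λ i P → ℕ→ℚ ⟦ avoids P ⟧ ℚ.* (c i ℚ.* ℕ→ℚ (H P i))) ⟩
      ∑ℚ Ps (λ P → ∑< (suc ρ) (λ i → ℕ→ℚ ⟦ avoids P ⟧ ℚ.* (c i ℚ.* ℕ→ℚ (H P i))))
        ≡⟨ ∑ℚ-cong Ps (λ P → trans (∑ℚ-*ˡ (upTo (suc ρ)) (ℕ→ℚ ⟦ avoids P ⟧) (λ i → c i ℚ.* ℕ→ℚ (H P i)))
             (trans (cong (ℕ→ℚ ⟦ avoids P ⟧ ℚ.*_) (inversion-at N ρ ρ≤N P))
                    (sym (ι-* ⟦ avoids P ⟧ ⟦ isSubspaceOfDim ρ ⟨ P ⟩ ⟧)))) ⟩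
      ∑ℚ Ps (λ P → ℕ→ℚ (⟦ avoids P ⟧ * ⟦ isSubspaceOfDim ρ ⟨ P ⟩ ⟧))
        ≡⟨ sym (ι-∑ Ps _) ⟩
      ℕ→ℚ (∑ Ps (λ P → ⟦ avoids P ⟧ * ⟦ isSubspaceOfDim ρ ⟨ P ⟩ ⟧)) ∎
      where
      open ≡-Reasoning
      c : ℕ → ℚ
      c i = coefficient (ρ ∸ i) ℚ.* gaussℕ q (N ∸ i) (ρ ∸ i)
      H : List (List (Pt N)) → ℕ → ℕ
      H P i = ∑ (Grass N i) (λ U → ⟦ inside U P ⟧)
      expand : ∀ i → c i ℚ.* ℕ→ℚ (pairs i) ≡ ∑ℚ Ps (λ P → ℕ→ℚ ⟦ avoids P ⟧ ℚ.* (c i ℚ.* ℕ→ℚ (H P i)))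
      expand i = trans (cong (λ n → c i ℚ.* ℕ→ℚ n)
          (trans (∑-swap (Grass N i) Ps (λ U P → ⟦ avoids P ⟧ * ⟦ inside U P ⟧))
                 (∑-cong Ps (λ P → ∑-*ˡ (Grass N i) ⟦ avoids P ⟧ (λ U → ⟦ inside U P ⟧)))))
        (trans (cong (c i ℚ.*_) (ι-∑ Ps (λ P → ⟦ avoids P ⟧ * H P i)))
        (trans (sym (∑ℚ-*ˡ Ps (c i) (λ P → ℕ→ℚ (⟦ avoids P ⟧ * H P i))))
        (∑ℚ-cong Ps (λ P → trans (cong (c i ℚ.*_) (ι-* ⟦ avoids P ⟧ (H P i)))
          (ℚ-Solver.solve 3 (λ x y z → x :* (y :* z) := y :* (x :* z)) refl (c i) (ℕ→ℚ ⟦ avoids P ⟧) (ℕ→ℚ (H P i)))))))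

  open Avoiding using (lam-counts)

  isPointSet : ∀ {N} → ℕ → ℕ → List (List (Pt N)) → Bool
  isPointSet ℓ ρ P = not (null P) ∧ does (length P ≟ ℓ) ∧ isSubspaceOfDim ρ ⟨ P ⟩

  isPointSet-nonNull : ∀ {N} ℓ ρ (P : List (List (Pt N))) → 0 < ℓ →
    isPointSet ℓ ρ P ≡ does (length P ≟ ℓ) ∧ isSubspaceOfDim ρ ⟨ P ⟩
  isPointSet-nonNull ℓ ρ (_ ∷ _) _ = refl
  isPointSet-nonNull (suc ℓ) ρ [] _ = refl

  module Average (N k ℓ ρ : ℕ) (k≤N : k ≤ N) (0<ℓ : 0 < ℓ) (ρ≤N : ρ ≤ N) where

    Ps = sublists (Grass N 1)
    PS = pointSets N ℓ ρ

    count-PS : (p : List (List (Pt N)) → Bool) →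
      ∑ PS (λ P → ⟦ p P ⟧) ≡ ∑ Ps (λ P → ⟦ does (length P ≟ ℓ) ∧ p P ⟧ * ⟦ isSubspaceOfDim ρ ⟨ P ⟩ ⟧)
    count-PS p = trans (∑-filterᵇ (isPointSet ℓ ρ) Ps (λ P → ⟦ p P ⟧))
      (∑-cong Ps (λ P → trans (cong (λ b → ⟦ b ⟧ * ⟦ p P ⟧) (isPointSet-nonNull ℓ ρ P 0<ℓ))
        (lem (does (length P ≟ ℓ)) (isSubspaceOfDim ρ ⟨ P ⟩) (p P))))
      where
      lem : ∀ a b c → ⟦ a ∧ b ⟧ * ⟦ c ⟧ ≡ ⟦ a ∧ c ⟧ * ⟦ b ⟧
      lem false b     c     = refl
      lem true  b     c     = *-comm ⟦ b ⟧ ⟦ c ⟧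

    -- The right side does not mention `W`, so each `k`-dimensional subspace is distinguishing for
    -- equally many point sets.
    lam-k : ∀ {W} → W ∈ Grass N k → ℕ→ℚ (∑ PS (λ P → ⟦ distinguishes W P ⟧)) ≡ lam q N k ℓ ρ
    lam-k {W} W∈ = trans (cong ℕ→ℚ (count-PS (distinguishes W)))
      (sym (lam-counts N k ℓ W (proj₁ (∈-Grass⁻ k W∈)) (proj₂ (∈-Grass⁻ k W∈)) ρ ρ≤N))

    -- The origin distinguishes every point set, because a line has `q > 1` vectors and the origin
    -- only one; the count for `s = 0` therefore runs over all point sets.
    lam-0 : ℕ→ℚ (length PS) ≡ lam q N 0 ℓ ρ
    lam-0 = trans (cong ℕ→ℚ (trans (sym (trans (∑-const PS 1) (*-identityʳ (length PS))))
        (trans (count-PS (λ _ → true)) (∑-cong∈ Ps (λ {P} P∈ →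
          cong (λ b → ⟦ does (length P ≟ ℓ) ∧ b ⟧ * ⟦ isSubspaceOfDim ρ ⟨ P ⟩ ⟧) (sym (trivial P P∈)))))))
      (sym (lam-counts N 0 ℓ O (Closed-cong (λ x → sym (mem-filterᵇ origin x)) origin-closed)
        (trans (size-cong (mem-filterᵇ {N} origin)) (size-origin N)) ρ ρ≤N))
      where
      O = filterᵇ origin (allVecs N)
      trivial : ∀ P → P ∈ Ps → distinguishes O P ≡ true
      trivial P P∈ = all-intro _ P (λ {L} L∈P → not-intro (λ h →
        let cL , sL = ∈-Grass⁻ 1 (∈-sublists⁻ (Grass N 1) P∈ L∈P)
        in <⇒≱ 1<q (subst₂ _≤_ (trans sL (*-identityʳ q)) (size-origin N)
             (size-mono {A = mem L} {origin} (λ {x} x∈ →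
               trans (sym (mem-filterᵇ origin x)) (all-elim (mem O) {L} h (mem-elim {S = L} {x} x∈)))))))

    -- After multiplication by the common denominator `g`, exchanging the sums leaves one equal
    -- summand for each of the `g` subspaces, and `g` cancels.
    sum-δ : sumℚ (map (δ N k) PS) ≡ lam q N k ℓ ρ
    sum-δ = ℚ-*-cancelʳ g≢0 (begin
      ∑ℚ PS (δ N k) ℚ.* ℕ→ℚ g
        ≡⟨ sym (∑ℚ-*ʳ PS (δ N k) (ℕ→ℚ g)) ⟩
      ∑ℚ PS (λ P → δ N k P ℚ.* ℕ→ℚ g)
        ≡⟨ ∑ℚ-cong PS (λ P → trans (/ℚ-* _ g≢0) (cong ℕ→ℚ (length-filterᵇ (λ W → distinguishes W P) (Grass N k)))) ⟩
      ∑ℚ PS (λ P → ℕ→ℚ (∑ (Grass N k) (λ W → ⟦ distinguishes W P ⟧)))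
        ≡⟨ sym (ι-∑ PS _) ⟩
      ℕ→ℚ (∑ PS (λ P → ∑ (Grass N k) (λ W → ⟦ distinguishes W P ⟧)))
        ≡⟨ cong ℕ→ℚ (∑-swap PS (Grass N k) (λ P W → ⟦ distinguishes W P ⟧)) ⟩
      ℕ→ℚ (∑ (Grass N k) (λ W → ∑ PS (λ P → ⟦ distinguishes W P ⟧)))
        ≡⟨ ι-∑-const (Grass N k) (λ W → ∑ PS (λ P → ⟦ distinguishes W P ⟧)) lam-k ⟩
      lam q N k ℓ ρ ℚ.* ℕ→ℚ g ∎)
      where
      open ≡-Reasoning
      g = length (Grass N k)
      g≢0 : ℕ→ℚ g ≢ 0ℚ
      g≢0 = ι-≢0 (Grass-nonEmpty N k k≤N)

    average : δ̂ N k ℓ ρ ≡ lam q N k ℓ ρ /ℚ lam q N 0 ℓ ρ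
    average = cong₂ _/ℚ_ sum-δ lam-0

theorem5p5 : {q : ℕ} (F : FiniteField q) → IsPrimePower q →
    (N k ℓ ρ : ℕ) → 3 ≤ N → 1 ≤ k → k ≤ N ∸ 1 → 2 ≤ ρ → ρ ≤ N →
    ρ ≤ ℓ → ℓ ≤ (q ^ ρ ∸ 1) /ℕ (q ∸ 1) →
    Over.δ̂ F N k ℓ ρ ≡ lam q N k ℓ ρ /ℚ lam q N 0 ℓ ρ
theorem5p5 F _ N k ℓ ρ _ _ k≤N∸1 2≤ρ ρ≤N ρ≤ℓ _ =
  Main.Average.average F N k ℓ ρ (≤-trans k≤N∸1 (m∸n≤m N 1)) (≤-trans (s≤s z≤n) (≤-trans 2≤ρ ρ≤ℓ)) ρ≤N
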